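{- Let $\mathcal{A}$ be a von Neumann algebra with predual $\mathcal{A}_*$. For a set $X$, let $\mathcal{I}_{\mathcal{A}}X$ be the set of finitary quantum instruments with values in $X$ (on $\mathcal{A}$). For a map $f:X\to Y$ and $\mathcal{E}\in\mathcal{I}_{\mathcal{A}}X$ put $$(\mathcal{I}_{\mathcal{A}}(f)(\mathcal{E}))(y,\rho)=(f_*\mathcal{E})(y,\rho):=\sum_{x\in f^{ -1}(y)}\mathcal{E}(x,\rho),\qquad y\in Y,\ \rho\in\mathcal{A}_*.$$ For every set $X$ define $\eta:X\to\mathcal{I}_{\mathcal{A}}X$ by $$\eta(x)(x',\rho):=\delta_{x,x'}\,\rho,$$ and $\mu:\mathcal{I}_{\mathcal{A}}\mathcal{I}_{\mathcal{A}}X\to\mathcal{I}_{\mathcal{A}}X$ by $$\mu(\mathcal{F})(x,\rho):=\sum_{\mathcal{E}\in\mathcal{I}_{\mathcal{A}}X}\mathcal{E}\bigl(x,\mathcal{F}(\mathcal{E},\rho)\bigr).$$ With these definitions, $\mathcal{I}_{\mathcal{A}}$ is a monad on the category $\mathsf{Set}$ of sets and functions, with unit $\eta$ and multiplication $\mu$.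
   Context: The predual $\mathcal{A}_*$ is the Banach space of normal linear functionals on $\mathcal{A}$, $\mathcal{A}_{*,+}$ is its cone of positive elements, and $\tau:\mathcal{A}_*\to\mathbb{C}$ is the canonical trace functional $\tau(\rho)=\rho(1)$. A linear map $\Phi:\mathcal{A}_*\to\mathcal{A}_*$ is completely positive if for every $n$ the entrywise map $\Phi^{(n)}$ on $M_n(\mathcal{A}_*)=M_n(\mathcal{A})_*$ maps positive elements to positive elements; it is trace-nonincreasing if $\tau(\Phi(\rho))\le\tau(\rho)$ for all $\rho\in\mathcal{A}_{*,+}$. A finitary quantum instrument with values in a set $X$ is a map $\mathcal{E}:X\times\mathcal{A}_*\to\mathcal{A}_*$ such that: (i) for every $x\in X$, the map $\mathcal{E}(x,-):\mathcal{A}_*\to\mathcal{A}_*$ is linear, completely positive and trace-nonincreasing; (ii) $\tau\bigl(\sum_{x\in X}\mathcal{E}(x,\rho)\bigr)=\tau(\rho)$ for all $\rho\in\mathcal{A}_*$; (iii) $\mathcal{E}(x,-)=0$ for all but finitely many $x\in X$. By (iii), all sums over outcomes in the claim have only finitely many nonzero terms. In $\mu$, an element $\mathcal{F}\in\mathcal{I}_{\mathcal{A}}\mathcal{I}_{\mathcal{A}}X$ is a finitary quantum instrument with values in the set $\mathcal{I}_{\mathcal{A}}X$. -}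

module Defs where

open import Algebra.Bundles using (CommutativeRing; RawMonoid; RawRing)
open import Algebra.Core using (Op₁; Op₂)
open import Algebra.Structures using (IsCommutativeRing)
open import Algebra.Module.Core using (Opₗ)
open import Algebra.Module.Structures using (IsLeftModule)
import Algebra.Definitions.RawMonoid as RawMonoidDefs
import Algebra.Properties.AbelianGroup as AbelianGroupProperties
import Algebra.Properties.CommutativeSemigroup as CommutativeSemigroupProperties
import Algebra.Properties.Ring as RingProperties
import Algebra.Properties.Semiring.Mult as SemiringMult
import Algebra.Solver.Ring as RingSolver
open import Algebra.Solver.Ring.AlmostCommutativeRing using (fromCommutativeRing; _-Raw-AlmostCommutative⟶_)
open import Axiom.ExcludedMiddle using (ExcludedMiddle)
open import Data.Bool.Base using (if_then_else_)
open import Data.Fin.Base using (Fin; toℕ)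
open import Data.Irrelevant as Irrelevant using (Irrelevant; [_])
open import Data.List.Base as List using (List; []; _∷_; _++_)
open import Data.List.Membership.Propositional using (_∉_)
open import Data.List.Relation.Unary.All using (All; []; _∷_)
open import Data.List.Relation.Unary.All.Properties using (++⁻ˡ; ++⁻ʳ)
open import Data.List.Relation.Unary.Unique.Propositional using (Unique)
open import Data.Maybe.Base using (Maybe; just; nothing)
open import Data.Nat.Base as ℕ using (ℕ)
import Data.Nat.Properties as ℕₚ
open import Data.Product.Base using (∃; _×_; _,_; proj₁; proj₂)
open import Data.Refinement using (Refinement-syntax; _,_; value; proof)
open import Data.Sum.Base using (inj₁; inj₂)
open import Function.Base using (_∘_; id)
open import Level using (Level; suc)
open import Relation.Binary.Core using (Rel)
open import Relation.Binary.PropositionalEquality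
  using (_≡_; _≢_; refl; sym; trans; cong; cong₂; subst; subst₂; isEquivalence)
open import Relation.Binary.Structures using (IsTotalOrder)
import Relation.Binary.Reasoning.Setoid as SetoidReasoning
import Relation.Binary.Construct.NonStrictToStrict as NonStrictToStrict
open import Relation.Nullary.Decidable using (Dec; yes; no; does; recompute)

-- The real numbers, as a Dedekind-complete ordered field; such a field is
-- unique up to unique isomorphism.
record RealNumbers (ℓ : Level) : Set (suc ℓ) where
  infix  8 -_
  infixl 7 _*_
  infixl 6 _+_ _-_
  infix  4 _≤_
  field
    Carrier : Set ℓ
    _+_ _*_ : Op₂ Carrier
    -_      : Op₁ Carrier
    0# 1#   : Carrier
    _≤_     : Rel Carrier ℓ
    isCommutativeRing : IsCommutativeRing _≡_ _+_ _*_ -_ 0# 1#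
    0≢1     : 0# ≢ 1#
    inverse : ∀ x → x ≢ 0# → ∃ λ y → x * y ≡ 1#
    isTotalOrder : IsTotalOrder _≡_ _≤_
    +-monoˡ-≤ : ∀ {x y} z → x ≤ y → x + z ≤ y + z
    *-nonneg  : ∀ {x y} → 0# ≤ x → 0# ≤ y → 0# ≤ x * y

  IsUpperBound : (Carrier → Set ℓ) → Carrier → Set ℓ
  IsUpperBound P b = ∀ x → P x → x ≤ b

  field
    supremum : ∀ (P : Carrier → Set ℓ) → ∃ P → ∃ (IsUpperBound P) →
               ∃ λ s → IsUpperBound P s × (∀ b → IsUpperBound P b → s ≤ b)

  open NonStrictToStrict {A = Carrier} _≡_ _≤_ public using (_<_)

  _-_ : Op₂ Carrier
  x - y = x + - y

  commutativeRing : CommutativeRing ℓ ℓ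
  commutativeRing = record { isCommutativeRing = isCommutativeRing }

  open RawMonoidDefs (CommutativeRing.+-rawMonoid commutativeRing) public using (sum)

module IntegerSolver {c ℓ : Level} (R : CommutativeRing c ℓ) where
  open CommutativeRing R renaming (refl to ≈-refl; sym to ≈-sym; trans to ≈-trans)
  open RingProperties ring using (-‿distribˡ-*; -‿distribʳ-*; -0#≈0#)
  open AbelianGroupProperties +-abelianGroup using (⁻¹-∙-comm; ⁻¹-involutive)
  open CommutativeSemigroupProperties +-commutativeSemigroup using (interchange)
  open SemiringMult semiring using (×-homo-+; ×1-homo-*; ×-congˡ) renaming (_×_ to _×ᴺ_)
  open SetoidReasoning setoid

  private
    -- The integer p - q is represented by the pair (p , q), one of which is zero.
    reduce : ℕ → ℕ → ℕ × ℕ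
    reduce (ℕ.suc p) (ℕ.suc q) = reduce p q
    reduce p         q         = p , q

    Coefficients : RawRing _ _
    Coefficients = record
      { Carrier = ℕ × ℕ
      ; _≈_ = _≡_
      ; _+_ = λ (p , q) (r , s) → reduce (p ℕ.+ r) (q ℕ.+ s)
      ; _*_ = λ (p , q) (r , s) → reduce (p ℕ.* r ℕ.+ q ℕ.* s) (p ℕ.* s ℕ.+ q ℕ.* r)
      ; -_  = λ (p , q) → q , p
      ; 0#  = 0 , 0
      ; 1#  = 1 , 0
      }

    n : ℕ → Carrier
    n m = m ×ᴺ 1#

    embed : ℕ × ℕ → Carrier
    embed (p , q) = n p + - n q

    cancel : ∀ a b d → (a + b) + (- d + - b) ≈ a + - d
    cancel a b d = ≈-trans (interchange a b (- d) (- b))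
                     (≈-trans (+-congˡ (-‿inverseʳ b)) (+-identityʳ (a + - d)))

    embed-reduce : ∀ p q → embed (reduce p q) ≈ n p + - n q
    embed-reduce ℕ.zero    q         = ≈-refl
    embed-reduce (ℕ.suc p) ℕ.zero    = ≈-refl
    embed-reduce (ℕ.suc p) (ℕ.suc q) = ≈-trans (embed-reduce p q) (≈-trans
      (≈-sym (cancel (n p) 1# (n q)))
      (+-cong (+-comm (n p) 1#) (≈-trans (⁻¹-∙-comm (n q) 1#) (-‿cong (+-comm (n q) 1#)))))

    product : ∀ a b c d → (a * c + b * d) + - (a * d + b * c) ≈ (a + - b) * (c + - d)
    product a b c d = begin
      (a * c + b * d) + - (a * d + b * c)
        ≈⟨ +-congˡ (≈-sym (⁻¹-∙-comm (a * d) (b * c))) ⟩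
      (a * c + b * d) + (- (a * d) + - (b * c))
        ≈⟨ +-congˡ (+-comm (- (a * d)) (- (b * c))) ⟩
      (a * c + b * d) + (- (b * c) + - (a * d))
        ≈⟨ interchange (a * c) (b * d) (- (b * c)) (- (a * d)) ⟩
      (a * c + - (b * c)) + (b * d + - (a * d))
        ≈⟨ +-cong (+-congˡ (-‿distribˡ-* b c)) (+-comm (b * d) (- (a * d))) ⟩
      (a * c + - b * c) + (- (a * d) + b * d)
        ≈⟨ +-cong (≈-sym (distribʳ c a (- b))) (+-cong (-‿distribʳ-* a d) bd) ⟩
      (a + - b) * c + (a * - d + - b * - d)
        ≈⟨ +-congˡ (≈-sym (distribʳ (- d) a (- b))) ⟩
      (a + - b) * c + (a + - b) * - d
        ≈⟨ ≈-sym (distribˡ (a + - b) c (- d)) ⟩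
      (a + - b) * (c + - d) ∎
      where
      bd : b * d ≈ - b * - d
      bd = begin
        b * d       ≈⟨ ≈-sym (⁻¹-involutive (b * d)) ⟩
        - - (b * d) ≈⟨ -‿cong (-‿distribˡ-* b d) ⟩
        - (- b * d) ≈⟨ -‿distribʳ-* (- b) d ⟩
        - b * - d   ∎

    morphism : Coefficients -Raw-AlmostCommutative⟶ fromCommutativeRing R
    morphism = record
      { ⟦_⟧    = embed
      ; +-homo = λ (p , q) (r , s) → ≈-trans (embed-reduce (p ℕ.+ r) (q ℕ.+ s)) (≈-trans
          (+-cong (×-homo-+ 1# p r) (≈-trans (-‿cong (×-homo-+ 1# q s)) (≈-sym (⁻¹-∙-comm (n q) (n s)))))
          (interchange (n p) (n r) (- n q) (- n s)))
      ; *-homo = λ (p , q) (r , s) → ≈-trans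
          (embed-reduce (p ℕ.* r ℕ.+ q ℕ.* s) (p ℕ.* s ℕ.+ q ℕ.* r)) (≈-trans
          (+-cong (≈-trans (×-homo-+ 1# (p ℕ.* r) (q ℕ.* s)) (+-cong (×1-homo-* p r) (×1-homo-* q s)))
                  (-‿cong (≈-trans (×-homo-+ 1# (p ℕ.* s) (q ℕ.* r)) (+-cong (×1-homo-* p s) (×1-homo-* q r)))))
          (product (n p) (n q) (n r) (n s)))
      ; -‿homo = λ (p , q) → ≈-trans (≈-trans (+-comm (n q) (- n p)) (+-congˡ (≈-sym (⁻¹-involutive (n q)))))
                                   (⁻¹-∙-comm (n p) (- n q))
      ; 0-homo = -‿inverseʳ 0#
      ; 1-homo = ≈-trans (+-congˡ -0#≈0#) (≈-trans (+-identityʳ (n 1)) (+-identityʳ 1#))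
      }

    equal? : ∀ x y → Maybe (embed x ≈ embed y)
    equal? (p , q) (r , s) with p ℕₚ.≟ r | q ℕₚ.≟ s
    ... | yes refl | yes refl = just ≈-refl
    ... | _        | _        = nothing

  open RingSolver Coefficients (fromCommutativeRing R) morphism equal? public
    using (solve; _:=_; _:+_; _:*_; :-_)

module RingIdentities {ℓ : Level} (ℝ : RealNumbers ℓ) where
  open RealNumbers ℝ using (_+_; _*_; -_; commutativeRing)
  open IntegerSolver commutativeRing

  -x+x-cancel : ∀ x y → (y + - x) + x ≡ y
  -x+x-cancel = solve 2 (λ x y →
    (y :+ :- x) :+ x
    := y) refl

  +x-x-cancel : ∀ x z → (x + z) + - z ≡ x
  +x-x-cancel = solve 2 (λ x z →
    (x :+ z) :+ :- z
    := x) refl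

  neg-square : ∀ x → (- x) * (- x) ≡ x * x
  neg-square = solve 1 (λ x →
    (:- x) :* (:- x)
    := x :* x) refl

  x*yy : ∀ x y → x * (y * y) ≡ (x * y) * y
  x*yy = solve 2 (λ x y →
    x :* (y :* y)
    := (x :* y) :* y) refl

  z*xy : ∀ x y z → z * (x * y) ≡ (x * z) * y
  z*xy = solve 3 (λ x y z →
    z :* (x :* y)
    := (x :* z) :* y) refl

  *-distrib-minus : ∀ x y z → z * (y + - x) ≡ z * y + - (z * x)
  *-distrib-minus = solve 3 (λ x y z →
    z :* (y :+ :- x)
    := z :* y :+ :- (z :* x)) refl

  doubling : ∀ u ε h → ε * (u * h) + ε * (u * h) ≡ ε * ((u + u) * h)
  doubling = solve 3 (λ u ε h →
    ε :* (u :* h) :+ ε :* (u :* h)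
    := ε :* ((u :+ u) :* h)) refl

  square-of-sum : ∀ u c → (u + c) * (u + c) + - (u * c) ≡ u * u + (u * c + c * c)
  square-of-sum = solve 2 (λ u c →
    (u :+ c) :* (u :+ c) :+ :- (u :* c)
    := u :* u :+ (u :* c :+ c :* c)) refl

  rescale : ∀ d c ε e → (d * d + - c) * ((ε * e) * (ε * e)) + c * ((ε * e) * (ε * e))
                        ≡ (ε * ε) * ((d * e) * (d * e))
  rescale = solve 4 (λ d c ε e →
    (d :* d :+ :- c) :* ((ε :* e) :* (ε :* e)) :+ c :* ((ε :* e) :* (ε :* e))
    := (ε :* ε) :* ((d :* e) :* (d :* e))) refl

  four-squares : ∀ δ → ((δ * δ) + (δ * δ)) + ((δ * δ) + (δ * δ)) ≡ (δ + δ) * (δ + δ)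
  four-squares = solve 1 (λ δ →
    ((δ :* δ) :+ (δ :* δ)) :+ ((δ :* δ) :+ (δ :* δ))
    := (δ :+ δ) :* (δ :+ δ)) refl

  parallelogram : ∀ a b c d →
    ((a * a + b * b) + (c * c + d * d)) + ((a * a + b * b) + (c * c + d * d))
    ≡ ((a + c) * (a + c) + (b + d) * (b + d)) + ((a + - c) * (a + - c) + (b + - d) * (b + - d))
  parallelogram = solve 4 (λ a b c d →
    ((a :* a :+ b :* b) :+ (c :* c :+ d :* d)) :+ ((a :* a :+ b :* b) :+ (c :* c :+ d :* d))
    := ((a :+ c) :* (a :+ c) :+ (b :+ d) :* (b :+ d)) :+ ((a :+ :- c) :* (a :+ :- c) :+ (b :+ :- d) :* (b :+ :- d))) refl

  two-squares-product : ∀ a b c d →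
    (a * c + - (b * d)) * (a * c + - (b * d)) + (a * d + b * c) * (a * d + b * c)
    ≡ (a * a + b * b) * (c * c + d * d)
  two-squares-product = solve 4 (λ a b c d →
    (a :* c :+ :- (b :* d)) :* (a :* c :+ :- (b :* d)) :+ (a :* d :+ b :* c) :* (a :* d :+ b :* c)
    := (a :* a :+ b :* b) :* (c :* c :+ d :* d)) refl

  interchange-minus : ∀ a b c d → (a + c) + - (b + d) ≡ (a + - b) + (c + - d)
  interchange-minus = solve 4 (λ a b c d →
    (a :+ c) :+ :- (b :+ d)
    := (a :+ :- b) :+ (c :+ :- d)) refl

  assoc-re : ∀ a b c d e f →
    (a * c + - (b * d)) * e + - ((a * d + b * c) * f) ≡ a * (c * e + - (d * f)) + - (b * (c * f + d * e))
  assoc-re = solve 6 (λ a b c d e f →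
    (a :* c :+ :- (b :* d)) :* e :+ :- ((a :* d :+ b :* c) :* f)
    := a :* (c :* e :+ :- (d :* f)) :+ :- (b :* (c :* f :+ d :* e))) refl

  assoc-im : ∀ a b c d e f →
    (a * c + - (b * d)) * f + (a * d + b * c) * e ≡ a * (c * f + d * e) + b * (c * e + - (d * f))
  assoc-im = solve 6 (λ a b c d e f →
    (a :* c :+ :- (b :* d)) :* f :+ (a :* d :+ b :* c) :* e
    := a :* (c :* f :+ d :* e) :+ b :* (c :* e :+ :- (d :* f))) refl

  distrib-re : ∀ a b c d e f → a * (c + e) + - (b * (d + f)) ≡ (a * c + - (b * d)) + (a * e + - (b * f))
  distrib-re = solve 6 (λ a b c d e f →
    a :* (c :+ e) :+ :- (b :* (d :+ f))
    := (a :* c :+ :- (b :* d)) :+ (a :* e :+ :- (b :* f))) refl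

  distrib-im : ∀ a b c d e f → a * (d + f) + b * (c + e) ≡ (a * d + b * c) + (a * f + b * e)
  distrib-im = solve 6 (λ a b c d e f →
    a :* (d :+ f) :+ b :* (c :+ e)
    := (a :* d :+ b :* c) :+ (a :* f :+ b :* e)) refl

  comm-re : ∀ a b c d → a * c + - (b * d) ≡ c * a + - (d * b)
  comm-re = solve 4 (λ a b c d →
    a :* c :+ :- (b :* d)
    := c :* a :+ :- (d :* b)) refl

  comm-im : ∀ a b c d → a * d + b * c ≡ c * b + d * a
  comm-im = solve 4 (λ a b c d →
    a :* d :+ b :* c
    := c :* b :+ d :* a) refl

  minus-re : ∀ a b c d e f →
    (a * c + - (b * d)) + - (a * e + - (b * f)) ≡ a * (c + - e) + - (b * (d + - f))
  minus-re = solve 6 (λ a b c d e f →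
    (a :* c :+ :- (b :* d)) :+ :- (a :* e :+ :- (b :* f))
    := a :* (c :+ :- e) :+ :- (b :* (d :+ :- f))) refl

  minus-im : ∀ a b c d e f →
    (a * d + b * c) + - (a * f + b * e) ≡ a * (d + - f) + b * (c + - e)
  minus-im = solve 6 (λ a b c d e f →
    (a :* d :+ b :* c) :+ :- (a :* f :+ b :* e)
    := a :* (d :+ :- f) :+ b :* (c :+ :- e)) refl

module RealLemmas {ℓ : Level} (ℝ : RealNumbers ℓ) where
  open RealNumbers ℝ
  open RingIdentities ℝ
  open IsCommutativeRing isCommutativeRing
    using (+-comm; +-identityˡ; +-identityʳ; *-identityˡ; *-identityʳ; zeroʳ; -‿inverseʳ)
  open IsTotalOrder isTotalOrder
    using (antisym; total) renaming (refl to ≤-refl; trans to ≤-trans)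

  +-mono-≤ : ∀ {a b c d} → a ≤ b → c ≤ d → a + c ≤ b + d
  +-mono-≤ {a} {b} {c} {d} p q =
    ≤-trans (+-monoˡ-≤ c p) (subst₂ _≤_ (+-comm c b) (+-comm d b) (+-monoˡ-≤ b q))

  ≤⇒0≤- : ∀ {x y} → x ≤ y → 0# ≤ y - x
  ≤⇒0≤- {x} {y} p = subst (_≤ y - x) (-‿inverseʳ x) (+-monoˡ-≤ (- x) p)

  0≤-⇒≤ : ∀ {x y} → 0# ≤ y - x → x ≤ y
  0≤-⇒≤ {x} {y} p = subst₂ _≤_ (+-identityˡ x) (-x+x-cancel x y) (+-monoˡ-≤ x p)

  ≤-<-trans : ∀ {x y z} → x ≤ y → y < z → x < z
  ≤-<-trans p (q , q≢) = ≤-trans p q , λ { refl → q≢ (antisym q p) }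

  <-≤-trans : ∀ {x y z} → x < y → y ≤ z → x < z
  <-≤-trans (p , p≢) q = ≤-trans p q , λ { refl → p≢ (antisym p q) }

  +-cancelʳ : ∀ {x y} z → x + z ≡ y + z → x ≡ y
  +-cancelʳ {x} {y} z e = trans (sym (+x-x-cancel x z)) (trans (cong (_- z) e) (+x-x-cancel y z))

  +-monoˡ-< : ∀ {x y} z → x < y → x + z < y + z
  +-monoˡ-< z (p , p≢) = +-monoˡ-≤ z p , p≢ ∘ +-cancelʳ z

  +-mono-< : ∀ {a b c d} → a < b → c < d → a + c < b + d
  +-mono-< {c = c} p (q , _) = <-≤-trans (+-monoˡ-< c p) (+-mono-≤ ≤-refl q)

  0≤x² : ∀ x → 0# ≤ x * x
  0≤x² x with total 0# x
  ... | inj₁ p = *-nonneg p p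
  ... | inj₂ p = subst (0# ≤_) (neg-square x) (*-nonneg 0≤-x 0≤-x)
    where
    0≤-x : 0# ≤ - x
    0≤-x = subst (0# ≤_) (+-identityˡ (- x)) (≤⇒0≤- p)

  0≤+ : ∀ {x y} → 0# ≤ x → 0# ≤ y → 0# ≤ x + y
  0≤+ {x} {y} p q = subst (_≤ x + y) (+-identityʳ 0#) (+-mono-≤ p q)

  0<+ : ∀ {x y} → 0# < x → 0# ≤ y → 0# < x + y
  0<+ {x} {y} p q = <-≤-trans p (subst (_≤ x + y) (+-identityʳ x) (+-mono-≤ ≤-refl q))

  0<1 : 0# < 1#
  0<1 = subst (0# ≤_) (*-identityʳ 1#) (0≤x² 1#) , 0≢1

  0<2 : 0# < 1# + 1#
  0<2 = 0<+ 0<1 (proj₁ 0<1)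

  0<⇒≢0 : ∀ {x} → 0# < x → x ≢ 0#
  0<⇒≢0 (_ , ne) e = ne (sym e)

  inverse-positive : ∀ {x y} → 0# < x → x * y ≡ 1# → 0# < y
  inverse-positive {x} {y} (p , _) e =
    subst (0# ≤_) (trans (x*yy x y) (trans (cong (_* y) e) (*-identityˡ y))) (*-nonneg p (0≤x² y))
    , λ { refl → 0≢1 (trans (sym (zeroʳ x)) e) }

  *-positive : ∀ {x y} → 0# < x → 0# < y → 0# < x * y
  *-positive {x} {y} (p , p≢) (q , q≢) = *-nonneg p q , ne
    where
    ne : 0# ≢ x * y
    ne e with inverse x (p≢ ∘ sym)
    ... | z , xz = q≢ (trans (trans (sym (zeroʳ z)) (trans (cong (z *_) e) (z*xy x y z)))
                             (trans (cong (_* y) xz) (*-identityˡ y)))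

  *-monoˡ-≤ : ∀ {x y z} → 0# ≤ z → x ≤ y → z * x ≤ z * y
  *-monoˡ-≤ {x} {y} {z} p q =
    0≤-⇒≤ (subst (0# ≤_) (*-distrib-minus x y z) (*-nonneg p (≤⇒0≤- q)))

  half : ∀ {ε} → 0# < ε → ∃ λ δ → 0# < δ × δ + δ ≡ ε
  half {ε} pos with inverse (1# + 1#) (0<⇒≢0 0<2)
  ... | h , e = ε * (1# * h)
              , *-positive pos (*-positive 0<1 (inverse-positive 0<2 e))
              , trans (doubling 1# ε h) (trans (cong (ε *_) e) (*-identityʳ ε))

  scale-down : ∀ {c ε} → 0# ≤ c → 0# < ε →
               ∃ λ δ → 0# < δ × (∀ {x} → x < δ * δ → c * x < ε * ε)
  scale-down {c} {ε} 0≤c 0<ε = go (inverse d (0<⇒≢0 0<d))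
    where
    d : Carrier
    d = 1# + c
    0<d : 0# < d
    0<d = 0<+ 0<1 0≤c
    0<d²-c : 0# < d * d - c
    0<d²-c = subst (λ t → 0# < d * d - t) (*-identityˡ c)
      (subst (0# <_) (sym (square-of-sum 1# c))
        (0<+ (*-positive 0<1 0<1) (0≤+ (*-nonneg (proj₁ 0<1) 0≤c) (0≤x² c))))
    go : (∃ λ e → d * e ≡ 1#) → ∃ λ δ → 0# < δ × (∀ {x} → x < δ * δ → c * x < ε * ε)
    go (e , de) = δ , 0<δ , λ x<δ² → ≤-<-trans (*-monoˡ-≤ 0≤c (proj₁ x<δ²)) cδ²<ε²
      where
      δ : Carrier
      δ = ε * e
      0<δ : 0# < δ
      0<δ = *-positive 0<ε (inverse-positive 0<d de)
      total-square : (d * d - c) * (δ * δ) + c * (δ * δ) ≡ ε * ε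
      total-square = trans (rescale d c ε e) (trans (cong (λ t → (ε * ε) * (t * t)) de)
                       (trans (cong ((ε * ε) *_) (*-identityʳ 1#)) (*-identityʳ (ε * ε))))
      cδ²<ε² : c * (δ * δ) < ε * ε
      cδ²<ε² = subst₂ _<_ (+-identityˡ (c * (δ * δ))) total-square
                 (+-monoˡ-< (c * (δ * δ)) (*-positive 0<d²-c (*-positive 0<δ 0<δ)))

module Complex {ℓ : Level} (ℝ : RealNumbers ℓ) where
  private module R = RealNumbers ℝ
  open RealLemmas ℝ
  open RingIdentities ℝ
  open IsCommutativeRing R.isCommutativeRing
    using (+-assoc; +-comm; +-identityˡ; +-identityʳ; *-identityˡ; zeroˡ; -‿inverseˡ; -‿inverseʳ)
  open R using () renaming (Carrier to ∣ℝ∣)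

  infix  8 -_
  infixl 7 _*_
  infixl 6 _+_ _-_
  infix  4 _≤_ ∣_∣<_

  record ℂ : Set ℓ where
    constructor _+i_
    field
      re im : ∣ℝ∣
  open ℂ public

  _+_ _*_ : Op₂ ℂ
  (a +i b) + (c +i d) = (a R.+ c) +i (b R.+ d)
  (a +i b) * (c +i d) = (a R.* c R.- b R.* d) +i (a R.* d R.+ b R.* c)

  -_ conj : Op₁ ℂ
  - (a +i b)    = (R.- a) +i (R.- b)
  conj (a +i b) = a +i (R.- b)

  0ℂ 1ℂ : ℂ
  0ℂ = R.0# +i R.0#
  1ℂ = R.1# +i R.0#

  _≤_ : Rel ℂ ℓ
  z ≤ w = re z R.≤ re w × im z ≡ im w

  ∣_∣² : ℂ → ∣ℝ∣
  ∣ a +i b ∣² = a R.* a R.+ b R.* b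

  -- |z| < ε for ε > 0, without square roots.
  ∣_∣<_ : ℂ → ∣ℝ∣ → Set ℓ
  ∣ z ∣< ε = ∣ z ∣² R.< ε R.* ε

  +-rawMonoid : RawMonoid ℓ ℓ
  +-rawMonoid = record { Carrier = ℂ ; _≈_ = _≡_ ; _∙_ = _+_ ; ε = 0ℂ }
  open RawMonoidDefs +-rawMonoid public using (sum)

  private
    -0≡0 : R.- R.0# ≡ R.0#
    -0≡0 = trans (sym (+-identityˡ (R.- R.0#))) (-‿inverseʳ R.0#)

    ℂ-+-comm : ∀ z w → z + w ≡ w + z
    ℂ-+-comm (a +i b) (c +i d) = cong₂ _+i_ (+-comm a c) (+-comm b d)

    ℂ-*-comm : ∀ z w → z * w ≡ w * z
    ℂ-*-comm (a +i b) (c +i d) = cong₂ _+i_ (comm-re a b c d) (comm-im a b c d)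

    ℂ-+-identityˡ : ∀ z → 0ℂ + z ≡ z
    ℂ-+-identityˡ (a +i b) = cong₂ _+i_ (+-identityˡ a) (+-identityˡ b)

    ℂ-*-identityˡ : ∀ z → 1ℂ * z ≡ z
    ℂ-*-identityˡ (a +i b) = cong₂ _+i_
      (trans (cong₂ R._-_ (*-identityˡ a) (zeroˡ b)) (trans (cong (a R.+_) -0≡0) (+-identityʳ a)))
      (trans (cong₂ R._+_ (*-identityˡ b) (zeroˡ a)) (+-identityʳ b))

    ℂ-*-distribˡ : ∀ z w v → z * (w + v) ≡ z * w + z * v
    ℂ-*-distribˡ (a +i b) (c +i d) (e +i f) =
      cong₂ _+i_ (distrib-re a b c d e f) (distrib-im a b c d e f)

  isCommutativeRing : IsCommutativeRing _≡_ _+_ _*_ -_ 0ℂ 1ℂ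
  isCommutativeRing = record
    { isRing = record
      { +-isAbelianGroup = record
        { isGroup = record
          { isMonoid = record
            { isSemigroup = record
              { isMagma = record { isEquivalence = isEquivalence ; ∙-cong = cong₂ _+_ }
              ; assoc   = λ { (a +i b) (c +i d) (e +i f) → cong₂ _+i_ (+-assoc a c e) (+-assoc b d f) }
              }
            ; identity = ℂ-+-identityˡ , λ z → trans (ℂ-+-comm z 0ℂ) (ℂ-+-identityˡ z)
            }
          ; inverse = (λ { (a +i b) → cong₂ _+i_ (-‿inverseˡ a) (-‿inverseˡ b) })
                    , (λ { (a +i b) → cong₂ _+i_ (-‿inverseʳ a) (-‿inverseʳ b) })
          ; ⁻¹-cong = cong -_
          }
        ; comm = ℂ-+-comm
        }
      ; *-cong     = cong₂ _*_
      ; *-assoc    = λ { (a +i b) (c +i d) (e +i f) →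
                         cong₂ _+i_ (assoc-re a b c d e f) (assoc-im a b c d e f) }
      ; *-identity = ℂ-*-identityˡ , λ z → trans (ℂ-*-comm z 1ℂ) (ℂ-*-identityˡ z)
      ; distrib    = ℂ-*-distribˡ
                   , λ z w v → trans (ℂ-*-comm (w + v) z)
                       (trans (ℂ-*-distribˡ z w v) (cong₂ _+_ (ℂ-*-comm z w) (ℂ-*-comm z v)))
      }
    ; *-comm = ℂ-*-comm
    }

  commutativeRing : CommutativeRing ℓ ℓ
  commutativeRing = record { isCommutativeRing = isCommutativeRing }

  _-_ : Op₂ ℂ
  z - w = z + (- w)

  HasSum : (ℕ → ℂ) → ℂ → Set ℓ
  HasSum f s = ∀ ε → R.0# R.< ε → ∃ λ N → ∀ n → N ℕ.≤ n → ∣ sum {n} (f ∘ toℕ) - s ∣< ε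

  0≤∣z∣² : ∀ z → R.0# R.≤ ∣ z ∣²
  0≤∣z∣² (a +i b) = 0≤+ (0≤x² a) (0≤x² b)

  ∣0∣< : ∀ {ε} → R.0# R.< ε → ∣ 0ℂ - 0ℂ ∣< ε
  ∣0∣< {ε} 0<ε = subst (λ t → (t R.* t R.+ t R.* t) R.< ε R.* ε) (sym (-‿inverseʳ R.0#))
    (subst (R._< ε R.* ε) (sym (trans (cong₂ R._+_ (zeroˡ R.0#) (zeroˡ R.0#)) (+-identityʳ R.0#))) (*-positive 0<ε 0<ε))

  ∣+∣< : ∀ {z w δ} → ∣ z ∣< δ → ∣ w ∣< δ → ∣ z + w ∣< (δ R.+ δ)
  ∣+∣< {a +i b} {c +i d} {δ} p q =
    ≤-<-trans bound (subst ((∣ Z ∣² R.+ ∣ W ∣²) R.+ (∣ Z ∣² R.+ ∣ W ∣²) R.<_) (four-squares δ) (+-mono-< (+-mono-< p q) (+-mono-< p q)))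
    where
    Z = a +i b
    W = c +i d
    bound : ∣ Z + W ∣² R.≤ (∣ Z ∣² R.+ ∣ W ∣²) R.+ (∣ Z ∣² R.+ ∣ W ∣²)
    bound = subst₂ R._≤_ (+-identityʳ ∣ Z + W ∣²) (sym (parallelogram a b c d))
              (+-mono-≤ (IsTotalOrder.refl R.isTotalOrder) (0≤∣z∣² (Z - W)))

  ∣*∣² : ∀ z w → ∣ z * w ∣² ≡ ∣ z ∣² R.* ∣ w ∣²
  ∣*∣² (a +i b) (c +i d) = two-squares-product a b c d

  +-minus-interchange : ∀ a b c d → (a + c) - (b + d) ≡ (a - b) + (c - d)
  +-minus-interchange (a +i a′) (b +i b′) (c +i c′) (d +i d′) =
    cong₂ _+i_ (interchange-minus a b c d) (interchange-minus a′ b′ c′ d′)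

  *-minus-distrib : ∀ c z w → c * z - c * w ≡ c * (z - w)
  *-minus-distrib (a +i b) (c +i d) (e +i f) =
    cong₂ _+i_ (minus-re a b c d e f) (minus-im a b c d e f)

  *-left-interchange : ∀ a b c → a * (b * c) ≡ b * (a * c)
  *-left-interchange a b c = trans (sym (IsCommutativeRing.*-assoc isCommutativeRing a b c))
    (trans (cong (_* c) (ℂ-*-comm a b)) (IsCommutativeRing.*-assoc isCommutativeRing b a c))

  +-interchange : ∀ a b c d → (a + b) + (c + d) ≡ (a + c) + (b + d)
  +-interchange a b c d = trans (assoc a b (c + d)) (trans (cong (a +_)
      (trans (sym (assoc b c d)) (trans (cong (_+ d) (ℂ-+-comm b c)) (assoc c b d))))
      (sym (assoc a c (b + d))))
    where assoc = IsCommutativeRing.+-assoc isCommutativeRing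

  ∣+∣<-differences : ∀ z z′ w w′ {δ} → ∣ z - z′ ∣< δ → ∣ w - w′ ∣< δ →
                     ∣ (z + w) - (z′ + w′) ∣< (δ R.+ δ)
  ∣+∣<-differences z z′ w w′ {δ} p q =
    subst (∣_∣< (δ R.+ δ)) (sym (+-minus-interchange z z′ w w′)) (∣+∣< {z - z′} {w - w′} p q)

  ∣*∣<-shrink : ∀ c z z′ {ε} → ∣ c ∣² R.* ∣ z - z′ ∣² R.< ε R.* ε → ∣ c * z - c * z′ ∣< ε
  ∣*∣<-shrink c z z′ {ε} = subst (R._< ε R.* ε) (sym square)
    where
    square : ∣ c * z - c * z′ ∣² ≡ ∣ c ∣² R.* ∣ z - z′ ∣²
    square = trans (cong ∣_∣² (*-minus-distrib c z z′)) (∣*∣² c (z - z′))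

record HilbertSpace {ℓ : Level} (ℝ : RealNumbers ℓ) : Set (suc ℓ) where
  private module R = RealNumbers ℝ
  open Complex ℝ hiding (_+_; -_; _-_)
  infix  8 -_
  infixr 7 _·_
  infixl 6 _+_ _-_
  field
    Carrier : Set ℓ
    _+_     : Op₂ Carrier
    -_      : Op₁ Carrier
    0ᴴ      : Carrier
    _·_     : Opₗ ℂ Carrier
    isLeftModule : IsLeftModule (CommutativeRing.ring commutativeRing) _≡_ _+_ 0ᴴ -_ _·_
    ⟨_,_⟩ : Carrier → Carrier → ℂ
    ⟨⟩-+ˡ     : ∀ x y z → ⟨ x + y , z ⟩ ≡ Complex._+_ ℝ ⟨ x , z ⟩ ⟨ y , z ⟩
    ⟨⟩-·ˡ     : ∀ c x y → ⟨ c · x , y ⟩ ≡ c * ⟨ x , y ⟩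
    ⟨⟩-conj   : ∀ x y → ⟨ y , x ⟩ ≡ conj ⟨ x , y ⟩
    ⟨⟩-nonneg : ∀ x → 0ℂ ≤ ⟨ x , x ⟩
    ⟨⟩-definite : ∀ x → ⟨ x , x ⟩ ≡ 0ℂ → x ≡ 0ᴴ

  ∥_∥² : Carrier → R.Carrier
  ∥ x ∥² = re ⟨ x , x ⟩

  _-_ : Op₂ Carrier
  x - y = x + (- y)

  field
    complete : ∀ (s : ℕ → Carrier) →
      (∀ ε → R.0# R.< ε → ∃ λ N → ∀ m n → N ℕ.≤ m → N ℕ.≤ n → ∥ s m - s n ∥² R.< ε R.* ε) →
      ∃ λ l → ∀ ε → R.0# R.< ε → ∃ λ N → ∀ n → N ℕ.≤ n → ∥ s n - l ∥² R.< ε R.* ε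

module Operators {ℓ : Level} {ℝ : RealNumbers ℓ} (H : HilbertSpace ℝ) where
  private
    module R = RealNumbers ℝ
    module H = HilbertSpace H
  open Complex ℝ
  open H using (⟨_,_⟩; ∥_∥²)

  IsBounded : (H.Carrier → H.Carrier) → Set ℓ
  IsBounded T = (∀ x y → T (x H.+ y) ≡ T x H.+ T y)
              × (∀ c x → T (c H.· x) ≡ c H.· T x)
              × ∃ λ C → ∀ x → ∥ T x ∥² R.≤ (C R.* C) R.* ∥ x ∥²

  IsAdjoint : (T T* : H.Carrier → H.Carrier) → Set ℓ
  IsAdjoint T T* = ∀ x y → ⟨ T x , y ⟩ ≡ ⟨ x , T* y ⟩

  InWeakClosure : ((H.Carrier → H.Carrier) → Set ℓ) → (H.Carrier → H.Carrier) → Set ℓ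
  InWeakClosure 𝒮 T = ∀ (L : List (H.Carrier × H.Carrier)) ε → R.0# R.< ε →
    ∃ λ S → 𝒮 S × All (λ (x , y) → ∣ ⟨ S x , y ⟩ - ⟨ T x , y ⟩ ∣< ε) L

  SquareSummable : (ℕ → H.Carrier) → Set ℓ
  SquareSummable ξ = ∃ λ B → ∀ n → R.sum {n} (λ k → ∥ ξ (toℕ k) ∥²) R.≤ B

-- A concrete von Neumann algebra: a unital *-subalgebra of B(H) closed in the
-- weak operator topology. Adjoints of bounded operators exist and are unique,
-- so adjoint-closed says exactly that T* lies in the algebra.
record VonNeumannAlgebra {ℓ : Level} {ℝ : RealNumbers ℓ} (H : HilbertSpace ℝ) : Set (suc ℓ) where
  private module H = HilbertSpace H
  open Complex ℝ using (ℂ)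
  open Operators H
  infix 4 _∈𝒜
  field
    _∈𝒜      : (H.Carrier → H.Carrier) → Set ℓ
    bounded  : ∀ {T} → T ∈𝒜 → IsBounded T
    id∈      : id ∈𝒜
    +-closed : ∀ {S T} → S ∈𝒜 → T ∈𝒜 → (λ x → S x H.+ T x) ∈𝒜
    ·-closed : ∀ (c : ℂ) {T} → T ∈𝒜 → (λ x → c H.· T x) ∈𝒜
    ∘-closed : ∀ {S T} → S ∈𝒜 → T ∈𝒜 → (S ∘ T) ∈𝒜
    adjoint-closed : ∀ {T} → T ∈𝒜 → ∃ λ T* → T* ∈𝒜 × IsAdjoint T T*
    weakly-closed  : ∀ {T} → IsBounded T → InWeakClosure _∈𝒜 T → T ∈𝒜

-- Subsets are refinement types, whose membership proofs are irrelevant, so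
-- that two elements are equal as soon as their underlying values are;
-- excluded middle makes the proofs available again.
module Instruments {ℓ : Level} (em : ExcludedMiddle ℓ) {ℝ : RealNumbers ℓ} {H : HilbertSpace ℝ}
                   (𝒜 : VonNeumannAlgebra H) where
  private
    module R = RealNumbers ℝ
    module H = HilbertSpace H
    module C = Complex ℝ
  open Complex ℝ using (ℂ; 0ℂ; 1ℂ; HasSum; ∣_∣<_)
  open Operators H
  open VonNeumannAlgebra 𝒜
  open RealLemmas ℝ using (half; scale-down)

  infixl 6 _⊕_
  infixr 7 _⊙_ _⊗_
  infix  9 _⋆

  private
    extract : ∀ {P : Set ℓ} → Irrelevant P → P
    extract [ p ] = recompute em p

  Element : Set ℓ
  Element = [ T ∈ (H.Carrier → H.Carrier) ∣ T ∈𝒜 ]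

  _⊕_ _⊗_ : Op₂ Element
  a ⊕ b = (λ x → value a x H.+ value b x) , Irrelevant.zipWith +-closed (proof a) (proof b)
  a ⊗ b = (value a ∘ value b) , Irrelevant.zipWith ∘-closed (proof a) (proof b)

  _⊙_ : Opₗ ℂ Element
  c ⊙ a = (λ x → c H.· value a x) , Irrelevant.map (·-closed c) (proof a)

  1ᴬ 0ᴬ : Element
  1ᴬ = id , [ id∈ ]
  0ᴬ = 0ℂ ⊙ 1ᴬ

  _⋆ : Op₁ Element
  a ⋆ = proj₁ adj , [ proj₁ (proj₂ adj) ]
    where adj = adjoint-closed (extract (proof a))

  ⊕-rawMonoid : RawMonoid ℓ ℓ
  ⊕-rawMonoid = record { Carrier = Element ; _≈_ = _≡_ ; _∙_ = _⊕_ ; ε = 0ᴬ }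
  open RawMonoidDefs ⊕-rawMonoid public using () renaming (sum to sumᴬ)

  -- The σ-weak topology is generated by the seminorms a ↦ |Σₖ ⟨a ξₖ, ηₖ⟩|
  -- for square-summable sequences ξ and η.
  record SubbasicBall : Set ℓ where
    field
      ξ η    : ℕ → H.Carrier
      ξ-summable : SquareSummable ξ
      η-summable : SquareSummable η
      radius : R.Carrier
      radius-positive : R.0# R.< radius

  -- b lies in the ball of this seminorm and radius around a.
  Within : Element → Element → SubbasicBall → Set ℓ
  Within a b B = ∃ λ s →
    HasSum (λ k → H.⟨ value b (ξ k) H.- value a (ξ k) , η k ⟩) s × ∣ s ∣< radius
    where open SubbasicBall B

  IsUltraweaklyContinuous : (Element → ℂ) → Set ℓ
  IsUltraweaklyContinuous φ = ∀ a ε → R.0# R.< ε →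
    ∃ λ (L : List SubbasicBall) → ∀ b → All (Within a b) L → ∣ φ b C.- φ a ∣< ε

  record IsNormalFunctional (φ : Element → ℂ) : Set ℓ where
    field
      additive    : ∀ a b → φ (a ⊕ b) ≡ φ a C.+ φ b
      homogeneous : ∀ c a → φ (c ⊙ a) ≡ c C.* φ a
      continuous  : IsUltraweaklyContinuous φ

  Predual : Set ℓ
  Predual = [ φ ∈ (Element → ℂ) ∣ IsNormalFunctional φ ]

  private
    open IsNormalFunctional

    zero-normal : IsNormalFunctional (λ _ → 0ℂ)
    zero-normal .additive a b = sym (CommutativeRing.+-identityˡ C.commutativeRing 0ℂ)
    zero-normal .homogeneous c a = sym (CommutativeRing.zeroʳ C.commutativeRing c)
    zero-normal .continuous a ε 0<ε = [] , λ _ _ → C.∣0∣< 0<ε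

    +-normal : ∀ {φ ψ} → IsNormalFunctional φ → IsNormalFunctional ψ →
               IsNormalFunctional (λ a → φ a C.+ ψ a)
    +-normal {φ} {ψ} p q .additive a b =
      trans (cong₂ C._+_ (p .additive a b) (q .additive a b)) (C.+-interchange (φ a) (φ b) (ψ a) (ψ b))
    +-normal {φ} {ψ} p q .homogeneous c a =
      trans (cong₂ C._+_ (p .homogeneous c a) (q .homogeneous c a))
            (sym (CommutativeRing.distribˡ C.commutativeRing c (φ a) (ψ a)))
    +-normal {φ} {ψ} p q .continuous a ε 0<ε = go (half 0<ε)
      where
      go : (∃ λ δ → R.0# R.< δ × δ R.+ δ ≡ ε) →
           ∃ λ (L : List SubbasicBall) → ∀ b → All (Within a b) L →
             ∣ (φ b C.+ ψ b) C.- (φ a C.+ ψ a) ∣< ε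
      go (δ , 0<δ , refl) = proj₁ near-φ ++ proj₁ near-ψ , λ b near →
        C.∣+∣<-differences (φ b) (φ a) (ψ b) (ψ a)
          (proj₂ near-φ b (++⁻ˡ (proj₁ near-φ) near)) (proj₂ near-ψ b (++⁻ʳ (proj₁ near-φ) near))
        where
        near-φ = p .continuous a δ 0<δ
        near-ψ = q .continuous a δ 0<δ

    ·-normal : ∀ c {φ} → IsNormalFunctional φ → IsNormalFunctional (λ a → c C.* φ a)
    ·-normal c {φ} p .additive a b =
      trans (cong (c C.*_) (p .additive a b)) (CommutativeRing.distribˡ C.commutativeRing c (φ a) (φ b))
    ·-normal c {φ} p .homogeneous d a =
      trans (cong (c C.*_) (p .homogeneous d a)) (C.*-left-interchange c d (φ a))
    ·-normal c {φ} p .continuous a ε 0<ε = go (scale-down (C.0≤∣z∣² c) 0<ε)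
      where
      go : (∃ λ δ → R.0# R.< δ × (∀ {x} → x R.< δ R.* δ → C.∣ c ∣² R.* x R.< ε R.* ε)) →
           ∃ λ (L : List SubbasicBall) → ∀ b → All (Within a b) L →
             ∣ c C.* φ b C.- c C.* φ a ∣< ε
      go (δ , 0<δ , shrink) = proj₁ near-φ , λ b near →
        C.∣*∣<-shrink c (φ b) (φ a) (shrink (proj₂ near-φ b near))
        where near-φ = p .continuous a δ 0<δ

  infixl 6 _+_
  infixr 7 _·_

  0* : Predual
  0* = (λ _ → 0ℂ) , [ zero-normal ]

  _+_ : Op₂ Predual
  ρ + σ = (λ a → value ρ a C.+ value σ a)
        , Irrelevant.zipWith +-normal (proof ρ) (proof σ)

  _·_ : Opₗ ℂ Predual
  c · ρ = (λ a → c C.* value ρ a) , Irrelevant.map (·-normal c) (proof ρ)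

  τ : Predual → ℂ
  τ ρ = value ρ 1ᴬ

  IsPositive : Predual → Set ℓ
  IsPositive ρ = ∀ a → 0ℂ C.≤ value ρ (a ⋆ ⊗ a)

  -- A matrix (ρᵢⱼ) over the predual is the functional (aᵢⱼ) ↦ Σᵢⱼ ρᵢⱼ(aᵢⱼ) on
  -- matrices over the algebra, whose positive elements are the x*x, with
  -- entries (x*x)ᵢⱼ = Σₖ xₖᵢ* xₖⱼ.
  IsPositiveMatrix : ∀ {n} → (Fin n → Fin n → Predual) → Set ℓ
  IsPositiveMatrix {n} ρ = ∀ (x : Fin n → Fin n → Element) →
    0ℂ C.≤ C.sum (λ i → C.sum (λ j → value (ρ i j) (sumᴬ (λ k → x k i ⋆ ⊗ x k j))))

  record IsLinear (Φ : Predual → Predual) : Set ℓ where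
    field
      additive    : ∀ ρ σ → Φ (ρ + σ) ≡ Φ ρ + Φ σ
      homogeneous : ∀ c ρ → Φ (c · ρ) ≡ c · Φ ρ

  IsCompletelyPositive : (Predual → Predual) → Set ℓ
  IsCompletelyPositive Φ = ∀ n (ρ : Fin n → Fin n → Predual) →
    IsPositiveMatrix ρ → IsPositiveMatrix (λ i j → Φ (ρ i j))

  IsTraceNonincreasing : (Predual → Predual) → Set ℓ
  IsTraceNonincreasing Φ = ∀ ρ → IsPositive ρ → τ (Φ ρ) C.≤ τ ρ

  FinitelySupported : {X : Set ℓ} → (X → Predual) → Set ℓ
  FinitelySupported {X} g = ∃ λ (L : List X) → Unique L × (∀ x → x ∉ L → g x ≡ 0*)

  -- The sum of a finitely supported family, and 0 for any other family.
  ∑ : {X : Set ℓ} → (X → Predual) → Predual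
  ∑ {X} g = go em
    where
    go : Dec (FinitelySupported g) → Predual
    go (yes (L , _)) = List.foldr _+_ 0* (List.map g L)
    go (no _)        = 0*

  ∑[_]_ : {X : Set ℓ} → (X → Set ℓ) → (X → Predual) → Predual
  ∑[ P ] g = ∑ (λ x → if does (em {P x}) then g x else 0*)

  record IsInstrument {X : Set ℓ} (ℰ : X → Predual → Predual) : Set ℓ where
    field
      linear              : ∀ x → IsLinear (ℰ x)
      completely-positive : ∀ x → IsCompletelyPositive (ℰ x)
      trace-nonincreasing : ∀ x → IsTraceNonincreasing (ℰ x)
      trace-preserving    : ∀ ρ → τ (∑ (λ x → ℰ x ρ)) ≡ τ ρ
      finitary            : ∃ λ (L : List X) → ∀ x → x ∉ L → ∀ ρ → ℰ x ρ ≡ 0*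

  Instrument : Set ℓ → Set ℓ
  Instrument X = [ ℰ ∈ (X → Predual → Predual) ∣ IsInstrument ℰ ]

  δ : {X : Set ℓ} → X → X → ℂ
  δ x x′ = if does (em {x ≡ x′}) then 1ℂ else 0ℂ

  pushforward : {X Y : Set ℓ} → (X → Y) → Instrument X → Y → Predual → Predual
  pushforward f ℰ y ρ = ∑[ (λ x → f x ≡ y) ] (λ x → value ℰ x ρ)

  unit : {X : Set ℓ} → X → X → Predual → Predual
  unit x x′ ρ = δ x x′ · ρ

  multiplication : {X : Set ℓ} → Instrument (Instrument X) → X → Predual → Predual
  multiplication {X} ℱ x ρ = ∑ (λ (ℰ : Instrument X) → value ℰ x (value ℱ ℰ ρ))

-- Monads on the category of sets (at level ℓ) and functions.
record Monad {ℓ : Level} (T : Set ℓ → Set ℓ) : Set (suc ℓ) where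
  field
    map : {X Y : Set ℓ} → (X → Y) → T X → T Y
    η   : {X : Set ℓ} → X → T X
    μ   : {X : Set ℓ} → T (T X) → T X
    map-id    : {X : Set ℓ} → map (id {A = X}) ≡ id
    map-∘     : {X Y Z : Set ℓ} (g : Y → Z) (f : X → Y) → map (g ∘ f) ≡ map g ∘ map f
    η-natural : {X Y : Set ℓ} (f : X → Y) → map f ∘ η ≡ η ∘ f
    μ-natural : {X Y : Set ℓ} (f : X → Y) → map f ∘ μ ≡ μ ∘ map (map f)
    μ∘η       : {X : Set ℓ} → μ ∘ η {T X} ≡ id
    μ∘map-η   : {X : Set ℓ} → μ ∘ map (η {X}) ≡ id
    μ-assoc   : {X : Set ℓ} → μ ∘ μ {T X} ≡ μ ∘ map (μ {X})

module Submission where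

open import Defs
open import Algebra.Bundles using (CommutativeMonoid; CommutativeRing)
open import Algebra.Module.Bundles using (LeftModule)
import Algebra.Properties.CommutativeMonoid.Sum as CommutativeMonoidSum
import Algebra.Properties.CommutativeSemigroup as CommutativeSemigroupProperties
import Algebra.Properties.Group as GroupProperties
open import Axiom.ExcludedMiddle using (ExcludedMiddle)
open import Axiom.Extensionality.Propositional using (Extensionality)
open import Data.Bool.Base using (if_then_else_)
open import Data.Fin.Base using (Fin; zero)
open import Data.Irrelevant using (Irrelevant; [_])
open import Data.List.Base as List using (List; []; _∷_; concatMap; deduplicate)
open import Data.List.Membership.Propositional using (_∈_; _∉_; lose)
open import Data.List.Membership.Propositional.Properties using (∈-concatMap⁺; ∈-deduplicate⁺; ∈-map⁺)
open import Data.List.Relation.Unary.All as All using (All; []; _∷_)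
open import Data.List.Relation.Unary.AllPairs using ([]; _∷_)
open import Data.List.Relation.Unary.Any using (here; there)
open import Data.List.Relation.Unary.Unique.Propositional using (Unique)
import Data.List.Relation.Unary.Unique.DecPropositional.Properties as UniqueDecProperties
open import Data.Product.Base using (Σ-syntax; _×_; _,_; proj₁; proj₂)
open import Data.Refinement using (value; proof; value-injective; _,_)
open import Function.Base using (_∘_; id)
open import Level using (Level)
open import Relation.Binary.Definitions using (DecidableEquality)
open import Relation.Binary.PropositionalEquality
  using (_≡_; _≢_; refl; sym; trans; cong; cong₂; subst; subst₂; isEquivalence; module ≡-Reasoning)
open import Relation.Binary.Structures using (IsTotalOrder)
open import Relation.Nullary.Decidable using (yes; no; does; recompute)
open import Relation.Nullary.Negation using (¬_; contradiction)

-- The completely positive linear maps on the predual contain 0 and id and are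
-- closed under composition and finite sums, which makes pushforwards and μ
-- outcomewise linear and completely positive. Outcomes are positive maps (complete
-- positivity on 1 × 1 matrices) and τ is nonnegative on positive elements, so traces
-- of partial sums are bounded by the total trace. Every monad law reduces to
-- exchanging two finitary sums and to the change of variables
-- ∑_y Φ_y((f_* ℰ)(y, ρ)) = ∑_x Φ_{f x}(ℰ(x, ρ)) for linear Φ_y.
module InstrumentMonad {ℓ : Level} (em : ExcludedMiddle ℓ) (ext : Extensionality ℓ ℓ)
                       {ℝ : RealNumbers ℓ} {H : HilbertSpace ℝ} (𝒜 : VonNeumannAlgebra H) where
  private
    module R = RealNumbers ℝ
    module ℝₚ = RealLemmas ℝ
    module ℝ≤ = IsTotalOrder R.isTotalOrder
    module H = HilbertSpace H
    module C = Complex ℝ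
    module ℂ = CommutativeRing C.commutativeRing
    module ℂ-Sum = CommutativeMonoidSum ℂ.+-commutativeMonoid
  open Complex ℝ using (ℂ; 0ℂ; 1ℂ)
  open Operators H using (IsAdjoint)
  open VonNeumannAlgebra 𝒜 using (adjoint-closed)
  open Instruments em 𝒜
  private module Normal = IsNormalFunctional
  open IsLinear
  open IsInstrument

  -- Irrelevant proofs and decided conditions.

  holds : {P : Set ℓ} → Irrelevant P → P
  holds [ p ] = recompute em p

  if-yes : {A P : Set ℓ} {a b : A} → P → (if does (em {P}) then a else b) ≡ a
  if-yes {P = P} p with em {P}
  ... | yes _ = refl
  ... | no ¬p = contradiction p ¬p

  if-no : {A P : Set ℓ} {a b : A} → ¬ P → (if does (em {P}) then a else b) ≡ b
  if-no {P = P} ¬p with em {P}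
  ... | yes p = contradiction p ¬p
  ... | no _  = refl

  -- The additive structure of the predual.

  normal : ∀ ρ → IsNormalFunctional (value ρ)
  normal ρ = holds {IsNormalFunctional (value ρ)} (proof ρ)

  Predual-ext : {ρ σ : Predual} → (∀ a → value ρ a ≡ value σ a) → ρ ≡ σ
  Predual-ext eq = value-injective (ext eq)

  +-commutativeMonoid : CommutativeMonoid ℓ ℓ
  +-commutativeMonoid = record
    { Carrier = Predual ; _≈_ = _≡_ ; _∙_ = _+_ ; ε = 0*
    ; isCommutativeMonoid = record
      { isMonoid = record
        { isSemigroup = record
          { isMagma = record { isEquivalence = isEquivalence ; ∙-cong = cong₂ _+_ }
          ; assoc = λ ρ σ υ → Predual-ext λ a → ℂ.+-assoc (value ρ a) (value σ a) (value υ a)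
          }
        ; identity = (λ ρ → Predual-ext λ a → ℂ.+-identityˡ (value ρ a))
                   , (λ ρ → Predual-ext λ a → ℂ.+-identityʳ (value ρ a))
        }
      ; comm = λ ρ σ → Predual-ext λ a → ℂ.+-comm (value ρ a) (value σ a)
      }
    }

  open CommutativeMonoid +-commutativeMonoid using (identityˡ; identityʳ; commutativeSemigroup)
  open CommutativeSemigroupProperties commutativeSemigroup using (interchange)

  ·-zeroˡ : ∀ ρ → 0ℂ · ρ ≡ 0*
  ·-zeroˡ ρ = Predual-ext λ a → ℂ.zeroˡ (value ρ a)

  ·-zeroʳ : ∀ c → c · 0* ≡ 0*
  ·-zeroʳ c = Predual-ext λ a → ℂ.zeroʳ c

  ·-identityˡ : ∀ ρ → 1ℂ · ρ ≡ ρ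
  ·-identityˡ ρ = Predual-ext λ a → ℂ.*-identityˡ (value ρ a)

  ·-distribˡ : ∀ c ρ σ → c · (ρ + σ) ≡ c · ρ + c · σ
  ·-distribˡ c ρ σ = Predual-ext λ a → ℂ.distribˡ c (value ρ a) (value σ a)

  -- Sums over lists.

  Σᴸ : {X : Set ℓ} → List X → (X → Predual) → Predual
  Σᴸ L g = List.foldr _+_ 0* (List.map g L)

  Σᴸ-cong : {X : Set ℓ} (L : List X) {g h : X → Predual} → (∀ x → g x ≡ h x) → Σᴸ L g ≡ Σᴸ L h
  Σᴸ-cong L eq = cong (Σᴸ L) (ext eq)

  Σᴸ-zero : {X : Set ℓ} {L : List X} {g : X → Predual} → All (λ x → g x ≡ 0*) L → Σᴸ L g ≡ 0*
  Σᴸ-zero []       = refl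
  Σᴸ-zero (e ∷ es) = trans (cong₂ _+_ e (Σᴸ-zero es)) (identityˡ 0*)

  Σᴸ-+ : {X : Set ℓ} (L : List X) (g h : X → Predual) → Σᴸ L (λ x → g x + h x) ≡ Σᴸ L g + Σᴸ L h
  Σᴸ-+ []      g h = sym (identityˡ 0*)
  Σᴸ-+ (x ∷ L) g h = trans (cong ((g x + h x) +_) (Σᴸ-+ L g h)) (interchange (g x) (h x) (Σᴸ L g) (Σᴸ L h))

  Σᴸ-swap : {X Y : Set ℓ} (L : List X) (M : List Y) (g : X → Y → Predual) →
            Σᴸ L (λ x → Σᴸ M (g x)) ≡ Σᴸ M (λ y → Σᴸ L (λ x → g x y))
  Σᴸ-swap []      M g = sym (Σᴸ-zero (All.universal (λ _ → refl) M))
  Σᴸ-swap (x ∷ L) M g =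
    trans (cong (Σᴸ M (g x) +_) (Σᴸ-swap L M g)) (sym (Σᴸ-+ M (g x) (λ y → Σᴸ L (λ x′ → g x′ y))))

  infix 3 _when_
  -- Has the form of the guard inside `∑[_]_`, so that `pushforward f ℰ y ρ` unfolds to
  -- `∑ (λ x → value ℰ x ρ when f x ≡ y)`.
  _when_ : Predual → Set ℓ → Predual
  ρ when P = if does (em {P}) then ρ else 0*

  when-zero : {P : Set ℓ} {ρ : Predual} → ρ ≡ 0* → (ρ when P) ≡ 0*
  when-zero {P} e with em {P}
  ... | yes _ = e
  ... | no _  = refl

  when-≡-sym : {X : Set ℓ} (g : X → Predual) (x y : X) → (g x when x ≡ y) ≡ (g y when y ≡ x)
  when-≡-sym g x y with em {x ≡ y}
  ... | yes refl = sym (if-yes refl)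
  ... | no x≢y   = sym (if-no (x≢y ∘ sym))

  -- Uniqueness lets `x` match at most one entry. If it matches none, the hypothesis on `ρ` makes
  -- both sides zero.
  Σᴸ-indicator : {X : Set ℓ} {M : List X} {x : X} {ρ : Predual} → Unique M → (x ∉ M → ρ ≡ 0*) →
                 Σᴸ M (λ y → ρ when x ≡ y) ≡ ρ
  Σᴸ-indicator [] ρ≡0 = sym (ρ≡0 λ ())
  Σᴸ-indicator {M = m ∷ M} {x} {ρ} (m∉M ∷ u) ρ≡0 with em {x ≡ m}
  ... | yes refl = trans (cong (ρ +_) (Σᴸ-zero (All.map if-no m∉M))) (identityʳ ρ)
  ... | no x≢m   = trans (identityˡ _) (Σᴸ-indicator u λ x∉M →
                     ρ≡0 λ { (here x≡m) → x≢m x≡m ; (there x∈M) → x∉M x∈M })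

  -- Finitely supported sums and their exchange.

  SupportedOn : {X : Set ℓ} → (X → Predual) → List X → Set ℓ
  SupportedOn g L = ∀ x → x ∉ L → g x ≡ 0*

  -- Both sums equal Σ_{x ∈ L} Σ_{y ∈ M} [x = y] g x.
  Σᴸ-unique : {X : Set ℓ} {g : X → Predual} {L M : List X} →
              Unique L → SupportedOn g L → Unique M → SupportedOn g M → Σᴸ L g ≡ Σᴸ M g
  Σᴸ-unique {g = g} {L} {M} uL sL uM sM = begin
    Σᴸ L g                                      ≡⟨ Σᴸ-cong L (λ x → Σᴸ-indicator uM (sM x)) ⟨
    Σᴸ L (λ x → Σᴸ M (λ y → g x when x ≡ y))    ≡⟨ Σᴸ-swap L M (λ x y → g x when x ≡ y) ⟩
    Σᴸ M (λ y → Σᴸ L (λ x → g x when x ≡ y))    ≡⟨ Σᴸ-cong M (λ y → Σᴸ-cong L (λ x → when-≡-sym g x y)) ⟩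
    Σᴸ M (λ y → Σᴸ L (λ x → g y when y ≡ x))    ≡⟨ Σᴸ-cong M (λ y → Σᴸ-indicator uL (sL y)) ⟩
    Σᴸ M g                                      ∎
    where open ≡-Reasoning

  -- Excluded middle supplies `∑` with some unknown duplicate-free support, which `Σᴸ-unique`
  -- replaces by the given one. The default value cannot arise, as `L` witnesses finite support.
  ∑≡Σᴸ : {X : Set ℓ} {g : X → Predual} {L : List X} → Unique L → SupportedOn g L → ∑ g ≡ Σᴸ L g
  ∑≡Σᴸ {g = g} u s with em {FinitelySupported g}
  ... | yes (M , v , t) = Σᴸ-unique v t u s
  ... | no ¬fin         = contradiction (_ , u , s) ¬fin

  module _ {X : Set ℓ} where
    private
      _≟_ : DecidableEquality X
      _ ≟ _ = em

    nub : List X → List X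
    nub = deduplicate _≟_

    -- Supports taken from instruments or built by `concatMap` may repeat entries; deduplication
    -- loses no members.
    ∑≡Σᴸ-nub : {g : X → Predual} {L : List X} → SupportedOn g L → ∑ g ≡ Σᴸ (nub L) g
    ∑≡Σᴸ-nub {L = L} s = ∑≡Σᴸ (UniqueDecProperties.deduplicate-! _≟_ L)
                               (λ x x∉ → s x (x∉ ∘ ∈-deduplicate⁺ _≟_))

    ∑-cong : {g h : X → Predual} → (∀ x → g x ≡ h x) → ∑ g ≡ ∑ h
    ∑-cong eq = cong ∑ (ext eq)

    ∑-zero : {g : X → Predual} → (∀ x → g x ≡ 0*) → ∑ g ≡ 0*
    ∑-zero eq = ∑≡Σᴸ [] (λ x _ → eq x)

    ∑-single : {g : X → Predual} (x : X) → (∀ y → x ≢ y → g y ≡ 0*) → ∑ g ≡ g x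
    ∑-single {g} x eq = trans (∑≡Σᴸ ([] ∷ []) (λ y y∉ → eq y (λ x≡y → y∉ (here (sym x≡y)))))
                              (identityʳ (g x))

    -- Evaluation at `1ᴬ` commutes with `_+_` by definition, so the bound is termwise once both sums
    -- run over one list.
    τ-∑-mono : {g h : X → Predual} {L : List X} → SupportedOn g L → SupportedOn h L →
               (∀ x → τ (g x) C.≤ τ (h x)) → τ (∑ g) C.≤ τ (∑ h)
    τ-∑-mono {g} {h} {L} sg sh le =
      subst₂ C._≤_ (cong τ (sym (∑≡Σᴸ-nub sg))) (cong τ (sym (∑≡Σᴸ-nub sh))) (mono (nub L))
      where
      mono : ∀ L → τ (Σᴸ L g) C.≤ τ (Σᴸ L h)
      mono []      = ℝ≤.refl , refl
      mono (x ∷ L) = ℝₚ.+-mono-≤ (proj₁ (le x)) (proj₁ (mono L))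
                   , cong₂ R._+_ (proj₂ (le x)) (proj₂ (mono L))

    -- Serves families that agree only after `τ`, such as functionals and their total outcomes under
    -- an instrument.
    τ-∑-cong : {g h : X → Predual} {L : List X} → SupportedOn g L → SupportedOn h L →
               (∀ x → τ (g x) ≡ τ (h x)) → τ (∑ g) ≡ τ (∑ h)
    τ-∑-cong {g} {h} {L} sg sh eq =
      trans (cong τ (∑≡Σᴸ-nub sg)) (trans (equal (nub L)) (cong τ (sym (∑≡Σᴸ-nub sh))))
      where
      equal : ∀ L → τ (Σᴸ L g) ≡ τ (Σᴸ L h)
      equal []      = refl
      equal (x ∷ L) = cong₂ C._+_ (eq x) (equal L)

  -- One list must serve every row: a row indexed in `L` is covered by its own `M x`, and any other
  -- row is zero.
  SupportedOn-concatMap : {X Y : Set ℓ} {g : X → Y → Predual} {L : List X} (M : X → List Y) →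
    (∀ y → SupportedOn (λ x → g x y) L) → (∀ x → SupportedOn (g x) (M x)) →
    ∀ x → SupportedOn (g x) (concatMap M L)
  SupportedOn-concatMap {L = L} M s t x y y∉ with em {x ∈ L}
  ... | yes x∈L = t x y (λ y∈M → y∉ (∈-concatMap⁺ M (lose x∈L y∈M)))
  ... | no x∉L  = s y x x∉L

  -- With the concatenated supports as a common support of all rows, both iterated sums run over two
  -- fixed lists.
  ∑-swap : {X Y : Set ℓ} {g : X → Y → Predual} {L : List X} (M : X → List Y) →
           (∀ y → SupportedOn (λ x → g x y) L) → (∀ x → SupportedOn (g x) (M x)) →
           ∑ (λ x → ∑ (g x)) ≡ ∑ (λ y → ∑ (λ x → g x y))
  ∑-swap {g = g} {L} M s t = begin
    ∑ (λ x → ∑ (g x))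
      ≡⟨ ∑≡Σᴸ-nub (λ x x∉ → ∑-zero (λ y → s y x x∉)) ⟩
    Σᴸ (nub L) (λ x → ∑ (g x))
      ≡⟨ Σᴸ-cong (nub L) (λ x → ∑≡Σᴸ-nub (t′ x)) ⟩
    Σᴸ (nub L) (λ x → Σᴸ (nub N) (g x))
      ≡⟨ Σᴸ-swap (nub L) (nub N) g ⟩
    Σᴸ (nub N) (λ y → Σᴸ (nub L) (λ x → g x y))
      ≡⟨ Σᴸ-cong (nub N) (λ y → ∑≡Σᴸ-nub (s y)) ⟨
    Σᴸ (nub N) (λ y → ∑ (λ x → g x y))
      ≡⟨ ∑≡Σᴸ-nub (λ y y∉ → ∑-zero (λ x → t′ x y y∉)) ⟨
    ∑ (λ y → ∑ (λ x → g x y)) ∎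
    where
    open ≡-Reasoning
    N  = concatMap M L
    t′ = SupportedOn-concatMap M s t

  -- Linear maps and change of variables.

  module _ {Φ : Predual → Predual} (lin : IsLinear Φ) where
    linear-0 : Φ 0* ≡ 0*
    linear-0 = trans (cong Φ (sym (·-zeroˡ 0*))) (trans (homogeneous lin 0ℂ 0*) (·-zeroˡ (Φ 0*)))

    -- Since `Φ` preserves `0*`, any support of `g` also supports `Φ ∘ g`, and additivity applies
    -- along that list.
    linear-∑ : {X : Set ℓ} {g : X → Predual} {L : List X} → SupportedOn g L → Φ (∑ g) ≡ ∑ (Φ ∘ g)
    linear-∑ {g = g} {L} s =
      trans (cong Φ (∑≡Σᴸ-nub s))
        (trans (go (nub L)) (sym (∑≡Σᴸ-nub (λ x x∉ → trans (cong Φ (s x x∉)) linear-0))))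
      where
      go : ∀ L → Φ (Σᴸ L g) ≡ Σᴸ L (Φ ∘ g)
      go []      = linear-0
      go (x ∷ L) = trans (additive lin (g x) (Σᴸ L g)) (cong (Φ (g x) +_) (go L))

  -- Linearity moves `Φ y` inside the fibre sum. After the exchange of sums, each `x` contributes
  -- only at `f x`, the base point of its fibre.
  ∑-fibres : {X Y : Set ℓ} {g : X → Predual} {L : List X} {Φ : Y → Predual → Predual} (f : X → Y) →
             SupportedOn g L → (∀ y → IsLinear (Φ y)) →
             ∑ (λ y → Φ y (∑ (λ x → g x when f x ≡ y))) ≡ ∑ (λ x → Φ (f x) (g x))
  ∑-fibres {g = g} {L} {Φ} f s lin = begin
    ∑ (λ y → Φ y (∑ (λ x → g x when f x ≡ y)))
      ≡⟨ ∑-cong (λ y → linear-∑ (lin y) (λ x x∉ → when-zero (s x x∉))) ⟩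
    ∑ (λ y → ∑ (λ x → Φ y (g x when f x ≡ y)))
      ≡⟨ ∑-swap {L = L} (λ x → f x ∷ [])
           (λ y x x∉ → trans (cong (Φ y) (when-zero (s x x∉))) (linear-0 (lin y)))
           (λ x y y∉ → off-fibre x y (λ fx≡y → y∉ (here (sym fx≡y)))) ⟨
    ∑ (λ x → ∑ (λ y → Φ y (g x when f x ≡ y)))
      ≡⟨ ∑-cong (λ x → ∑-single (f x) (off-fibre x)) ⟩
    ∑ (λ x → Φ (f x) (g x when f x ≡ f x))
      ≡⟨ ∑-cong (λ x → cong (Φ (f x)) (if-yes refl)) ⟩
    ∑ (λ x → Φ (f x) (g x)) ∎
    where
    open ≡-Reasoning
    off-fibre : ∀ x y → f x ≢ y → Φ y (g x when f x ≡ y) ≡ 0*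
    off-fibre x y fx≢y = trans (cong (Φ y) (if-no fx≢y)) (linear-0 (lin y))

  -- Positivity and the trace.

  0≤+0≤ : ∀ {z w} → 0ℂ C.≤ z → 0ℂ C.≤ w → 0ℂ C.≤ z C.+ w
  0≤+0≤ (p , e) (q , f) = ℝₚ.0≤+ p q , trans (sym (cong C.im (ℂ.+-identityˡ 0ℂ))) (cong₂ R._+_ e f)

  ≤-reflexive : ∀ {z w} → z ≡ w → z C.≤ w
  ≤-reflexive refl = ℝ≤.refl , refl

  -- Positivity is tested on elements `a ⋆ ⊗ a`; this makes `1ᴬ`, where `τ` evaluates, one of them.
  -- Only the adjoint identity is known of `1ᴬ ⋆`, so `1* x - x` is shown to be orthogonal to
  -- itself.
  1⋆⊗1≡1 : 1ᴬ ⋆ ⊗ 1ᴬ ≡ 1ᴬ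
  1⋆⊗1≡1 = value-injective (ext fixes)
    where
    leftModule : LeftModule ℂ.ring ℓ ℓ
    leftModule = record { isLeftModule = H.isLeftModule }
    open LeftModule leftModule using (+ᴹ-group; *ₗ-zeroˡ; -ᴹ‿inverseʳ)
    open GroupProperties +ᴹ-group using (x∙y⁻¹≈ε⇒x≈y)
    open ≡-Reasoning
    1* : H.Carrier → H.Carrier
    1* = value (1ᴬ ⋆)
    adjoint : IsAdjoint id 1*
    -- `holds` recomputes the membership proof just as `_⋆` does, so this is the same adjoint by
    -- definition.
    adjoint = proj₂ (proj₂ (adjoint-closed (holds (proof 1ᴬ))))
    ⟨0,_⟩ : ∀ x → H.⟨ H.0ᴴ , x ⟩ ≡ 0ℂ
    ⟨0, x ⟩ = begin
      H.⟨ H.0ᴴ , x ⟩            ≡⟨ cong H.⟨_, x ⟩ (*ₗ-zeroˡ H.0ᴴ) ⟨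
      H.⟨ 0ℂ H.· H.0ᴴ , x ⟩     ≡⟨ H.⟨⟩-·ˡ 0ℂ H.0ᴴ x ⟩
      0ℂ C.* H.⟨ H.0ᴴ , x ⟩     ≡⟨ ℂ.zeroˡ H.⟨ H.0ᴴ , x ⟩ ⟩
      0ℂ                        ∎
    adjointˡ : ∀ x y → H.⟨ 1* x , y ⟩ ≡ H.⟨ x , y ⟩
    adjointˡ x y = begin
      H.⟨ 1* x , y ⟩          ≡⟨ H.⟨⟩-conj y (1* x) ⟩
      C.conj H.⟨ y , 1* x ⟩   ≡⟨ cong C.conj (adjoint y x) ⟨
      C.conj H.⟨ y , x ⟩      ≡⟨ H.⟨⟩-conj y x ⟨
      H.⟨ x , y ⟩             ∎
    fixes : ∀ x → 1* x ≡ x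
    fixes x = x∙y⁻¹≈ε⇒x≈y (1* x) x (H.⟨⟩-definite d (begin
      H.⟨ d , d ⟩                                ≡⟨ H.⟨⟩-+ˡ (1* x) (H.- x) d ⟩
      H.⟨ 1* x , d ⟩ C.+ H.⟨ H.- x , d ⟩         ≡⟨ cong (C._+ H.⟨ H.- x , d ⟩) (adjointˡ x d) ⟩
      H.⟨ x , d ⟩ C.+ H.⟨ H.- x , d ⟩            ≡⟨ H.⟨⟩-+ˡ x (H.- x) d ⟨
      H.⟨ x H.+ (H.- x) , d ⟩                    ≡⟨ cong H.⟨_, d ⟩ (-ᴹ‿inverseʳ x) ⟩
      H.⟨ H.0ᴴ , d ⟩                             ≡⟨ ⟨0, d ⟩ ⟩
      0ℂ                                         ∎))
      where d = 1* x H.- x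

  τ-nonneg : ∀ ρ → IsPositive ρ → 0ℂ C.≤ τ ρ
  τ-nonneg ρ p = subst (λ a → 0ℂ C.≤ value ρ a) 1⋆⊗1≡1 (p 1ᴬ)

  value-0ᴬ : ∀ ρ → value ρ 0ᴬ ≡ 0ℂ
  value-0ᴬ ρ = trans (Normal.homogeneous (normal ρ) 0ℂ 1ᴬ) (ℂ.zeroˡ (value ρ 1ᴬ))

  -- This is complete positivity at `n = 1`, up to trailing zeros.
  CP⇒positive : ∀ {Φ} → IsCompletelyPositive Φ → ∀ ρ → IsPositive ρ → IsPositive (Φ ρ)
  CP⇒positive {Φ} cp ρ pos a =
    subst (0ℂ C.≤_) (1×1 (Φ ρ) (a ⋆ ⊗ a))
      (cp 1 (λ _ _ → ρ)
        (λ x → subst (0ℂ C.≤_) (sym (1×1 ρ (x zero zero ⋆ ⊗ x zero zero))) (pos (x zero zero)))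
        (λ _ _ → a))
    where
    -- Sums over `Fin 1` unfold to one `0ᴬ` inside `ρ` and two zeros outside; linearity of `ρ`
    -- removes the first.
    1×1 : ∀ ρ a → (value ρ (a ⊕ 0ᴬ) C.+ 0ℂ) C.+ 0ℂ ≡ value ρ a
    1×1 ρ a = begin
      (value ρ (a ⊕ 0ᴬ) C.+ 0ℂ) C.+ 0ℂ   ≡⟨ ℂ.+-identityʳ (value ρ (a ⊕ 0ᴬ) C.+ 0ℂ) ⟩
      value ρ (a ⊕ 0ᴬ) C.+ 0ℂ            ≡⟨ ℂ.+-identityʳ (value ρ (a ⊕ 0ᴬ)) ⟩
      value ρ (a ⊕ 0ᴬ)                   ≡⟨ Normal.additive (normal ρ) a 0ᴬ ⟩
      value ρ a C.+ value ρ 0ᴬ           ≡⟨ cong (value ρ a C.+_) (value-0ᴬ ρ) ⟩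
      value ρ a C.+ 0ℂ                   ≡⟨ ℂ.+-identityʳ (value ρ a) ⟩
      value ρ a                          ∎
      where open ≡-Reasoning

  positive-matrix-0 : ∀ n → IsPositiveMatrix {n} (λ _ _ → 0*)
  positive-matrix-0 n x = ≤-reflexive (sym
    (trans (ℂ-Sum.sum-cong-≗ {n} (λ _ → ℂ-Sum.sum-replicate-zero n)) (ℂ-Sum.sum-replicate-zero n)))

  positive-matrix-+ : ∀ {n} (ρ σ : Fin n → Fin n → Predual) → IsPositiveMatrix ρ → IsPositiveMatrix σ →
                      IsPositiveMatrix (λ i j → ρ i j + σ i j)
  positive-matrix-+ {n} ρ σ p q x = subst (0ℂ C.≤_) (sym (begin
    C.sum (λ i → C.sum (λ j → v ρ i j C.+ v σ i j))
      ≡⟨ ℂ-Sum.sum-cong-≗ {n} (λ i → ℂ-Sum.∑-distrib-+ {n} (v ρ i) (v σ i)) ⟩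
    C.sum (λ i → C.sum (v ρ i) C.+ C.sum (v σ i))
      ≡⟨ ℂ-Sum.∑-distrib-+ {n} (λ i → C.sum (v ρ i)) (λ i → C.sum (v σ i)) ⟩
    C.sum (λ i → C.sum (v ρ i)) C.+ C.sum (λ i → C.sum (v σ i)) ∎)) (0≤+0≤ (p x) (q x))
    where
    open ≡-Reasoning
    v : (Fin n → Fin n → Predual) → Fin n → Fin n → ℂ
    v ρ i j = value (ρ i j) (sumᴬ (λ k → x k i ⋆ ⊗ x k j))

  -- Completely positive linear maps.

  record IsCPLinear (Φ : Predual → Predual) : Set ℓ where
    constructor _,_
    field
      isLinear : IsLinear Φ
      isCP     : IsCompletelyPositive Φ
  open IsCPLinear

  0-CPLinear : IsCPLinear (λ _ → 0*)
  0-CPLinear = record { additive = λ _ _ → sym (identityˡ 0*) ; homogeneous = λ c _ → sym (·-zeroʳ c) }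
             , λ n _ _ → positive-matrix-0 n

  id-CPLinear : IsCPLinear id
  id-CPLinear = record { additive = λ _ _ → refl ; homogeneous = λ _ _ → refl } , λ _ _ → id

  ∘-CPLinear : ∀ {Φ Ψ} → IsCPLinear Φ → IsCPLinear Ψ → IsCPLinear (Φ ∘ Ψ)
  ∘-CPLinear {Φ} {Ψ} (l , p) (m , q) = record
    { additive    = λ ρ σ → trans (cong Φ (additive m ρ σ)) (additive l (Ψ ρ) (Ψ σ))
    ; homogeneous = λ c ρ → trans (cong Φ (homogeneous m c ρ)) (homogeneous l c (Ψ ρ))
    } , λ n ρ → p n (λ i j → Ψ (ρ i j)) ∘ q n ρ

  +-CPLinear : ∀ {Φ Ψ} → IsCPLinear Φ → IsCPLinear Ψ → IsCPLinear (λ ρ → Φ ρ + Ψ ρ)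
  +-CPLinear {Φ} {Ψ} (l , p) (m , q) = record
    { additive    = λ ρ σ → trans (cong₂ _+_ (additive l ρ σ) (additive m ρ σ))
                                  (interchange (Φ ρ) (Φ σ) (Ψ ρ) (Ψ σ))
    ; homogeneous = λ c ρ → trans (cong₂ _+_ (homogeneous l c ρ) (homogeneous m c ρ))
                                  (sym (·-distribˡ c (Φ ρ) (Ψ ρ)))
    } , λ n ρ pos → positive-matrix-+ (λ i j → Φ (ρ i j)) (λ i j → Ψ (ρ i j)) (p n ρ pos) (q n ρ pos)

  -- The condition does not involve `ρ`, so the map is either `Φ` or zero. With `Φ = id`, the guard
  -- itself is a linear map, as the monad laws need.
  when-CPLinear : ∀ {Φ} (P : Set ℓ) → IsCPLinear Φ → IsCPLinear (λ ρ → Φ ρ when P)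
  when-CPLinear P op with em {P}
  ... | yes _ = op
  ... | no _  = 0-CPLinear

  -- One list supports the family for all `ρ`, so this is a fixed finite sum of maps.
  ∑-CPLinear : {X : Set ℓ} {Φ : X → Predual → Predual} {L : List X} →
               (∀ ρ → SupportedOn (λ x → Φ x ρ) L) → (∀ x → IsCPLinear (Φ x)) →
               IsCPLinear (λ ρ → ∑ (λ x → Φ x ρ))
  ∑-CPLinear {Φ = Φ} {L} s ops = subst IsCPLinear (ext λ ρ → sym (∑≡Σᴸ-nub (s ρ))) (go (nub L))
    where
    go : ∀ L → IsCPLinear (λ ρ → Σᴸ L (λ x → Φ x ρ))
    go []      = 0-CPLinear
    go (x ∷ L) = +-CPLinear (ops x) (go L)

  -- Instruments and their outcome maps.

  Instrument-ext : {X : Set ℓ} {ℰ ℱ : Instrument X} → (∀ x ρ → value ℰ x ρ ≡ value ℱ x ρ) → ℰ ≡ ℱ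
  Instrument-ext eq = value-injective (ext λ x → ext (eq x))

  module _ {X : Set ℓ} (ℰ : Instrument X) where
    private laws = holds (proof ℰ)

    support : List X
    support = proj₁ (finitary laws)

    supported : ∀ ρ → SupportedOn (λ x → value ℰ x ρ) support
    supported ρ x x∉ = proj₂ (finitary laws) x x∉ ρ

    outcome-CPLinear : ∀ x → IsCPLinear (value ℰ x)
    outcome-CPLinear x = linear laws x , completely-positive laws x

    outcome-positive : ∀ x ρ → IsPositive ρ → IsPositive (value ℰ x ρ)
    outcome-positive x = CP⇒positive {value ℰ x} (completely-positive laws x)

    outcome-0 : ∀ x → value ℰ x 0* ≡ 0*
    outcome-0 x = linear-0 (linear laws x)

    outcome-τ≤ : ∀ x → IsTraceNonincreasing (value ℰ x)
    outcome-τ≤ = trace-nonincreasing laws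

    total-τ : ∀ ρ → τ (∑ (λ x → value ℰ x ρ)) ≡ τ ρ
    total-τ = trace-preserving laws

  -- Functorial action by pushforward.

  map : {X Y : Set ℓ} → (X → Y) → Instrument X → Instrument Y
  map {X} {Y} f ℰ = pushforward f ℰ , [ isInstrument ]
    where
    fibre-supported : ∀ y ρ → SupportedOn (λ x → value ℰ x ρ when f x ≡ y) (support ℰ)
    fibre-supported y ρ x x∉ = when-zero (supported ℰ ρ x x∉)

    fibre-τ≤ : ∀ y ρ → IsPositive ρ → ∀ x → τ (value ℰ x ρ when f x ≡ y) C.≤ τ (value ℰ x ρ)
    fibre-τ≤ y ρ pos x with em {f x ≡ y}
    ... | yes _ = ≤-reflexive refl
    -- Dropping an outcome replaces its trace by zero, which is no larger because the outcome is
    -- positive.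
    ... | no _  = τ-nonneg (value ℰ x ρ) (outcome-positive ℰ x ρ pos)

    cpLinear : ∀ y → IsCPLinear (pushforward f ℰ y)
    cpLinear y = ∑-CPLinear (fibre-supported y) (λ x → when-CPLinear (f x ≡ y) (outcome-CPLinear ℰ x))

    isInstrument : IsInstrument (pushforward f ℰ)
    isInstrument .linear y = isLinear (cpLinear y)
    isInstrument .completely-positive y = isCP (cpLinear y)
    isInstrument .trace-nonincreasing y ρ pos =
      subst (τ (pushforward f ℰ y ρ) C.≤_) (total-τ ℰ ρ)
        (τ-∑-mono (fibre-supported y ρ) (supported ℰ ρ) (fibre-τ≤ y ρ pos))
    isInstrument .trace-preserving ρ =
      -- This is the change of variables with every `Φ y` the identity.
      trans (cong τ (∑-fibres f (supported ℰ ρ) (λ _ → isLinear id-CPLinear))) (total-τ ℰ ρ)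
    isInstrument .finitary = List.map f (support ℰ) , λ y y∉ ρ → ∑-zero (off-image y∉ ρ)
      where
      off-image : ∀ {y} → y ∉ List.map f (support ℰ) → ∀ ρ x → (value ℰ x ρ when f x ≡ y) ≡ 0*
      off-image {y} y∉ ρ x with em {f x ≡ y}
      ... | yes refl = supported ℰ ρ x (y∉ ∘ ∈-map⁺ f)
      ... | no _     = refl

  -- The unit.

  unit-≡ : {X : Set ℓ} (x : X) (ρ : Predual) → unit x x ρ ≡ ρ
  unit-≡ x ρ = trans (cong (_· ρ) (if-yes refl)) (·-identityˡ ρ)

  unit-≢ : {X : Set ℓ} {x y : X} → x ≢ y → ∀ ρ → unit x y ρ ≡ 0*
  unit-≢ x≢y ρ = trans (cong (_· ρ) (if-no x≢y)) (·-zeroˡ ρ)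

  -- Turns the scalar `δ` into a guard, so that `when-CPLinear` applies to the outcomes of `η x`.
  unit-when : {X : Set ℓ} (x y : X) (ρ : Predual) → unit x y ρ ≡ (ρ when x ≡ y)
  unit-when x y ρ with em {x ≡ y}
  ... | yes _ = ·-identityˡ ρ
  ... | no _  = ·-zeroˡ ρ

  η : {X : Set ℓ} → X → Instrument X
  η {X} x = unit x , [ isInstrument ]
    where
    cpLinear : ∀ y → IsCPLinear (unit x y)
    cpLinear y = subst IsCPLinear (ext λ ρ → sym (unit-when x y ρ)) (when-CPLinear (x ≡ y) id-CPLinear)

    isInstrument : IsInstrument (unit x)
    isInstrument .linear y = isLinear (cpLinear y)
    isInstrument .completely-positive y = isCP (cpLinear y)
    isInstrument .trace-nonincreasing y ρ pos with em {x ≡ y}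
    ... | yes _ = ≤-reflexive (cong τ (·-identityˡ ρ))
    ... | no _  = subst (λ σ → τ σ C.≤ τ ρ) (sym (·-zeroˡ ρ)) (τ-nonneg ρ pos)
    isInstrument .trace-preserving ρ =
      cong τ (trans (∑-single x (λ y x≢y → unit-≢ x≢y ρ)) (unit-≡ x ρ))
    isInstrument .finitary = x ∷ [] , λ y y∉ → unit-≢ (λ x≡y → y∉ (here (sym x≡y)))

  -- The multiplication.

  composite-supported : {X : Set ℓ} (ℱ : Instrument (Instrument X)) (ρ : Predual) (x : X) →
                        SupportedOn (λ ℰ → value ℰ x (value ℱ ℰ ρ)) (support ℱ)
  -- Outside `support ℱ` the outcome map is applied to `0*`, which it preserves.
  composite-supported ℱ ρ x ℰ ℰ∉ = trans (cong (value ℰ x) (supported ℱ ρ ℰ ℰ∉)) (outcome-0 ℰ x)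

  μ : {X : Set ℓ} → Instrument (Instrument X) → Instrument X
  μ {X} ℱ = multiplication ℱ , [ isInstrument ]
    where
    outer : ∀ ρ x → SupportedOn (λ ℰ → value ℰ x (value ℱ ℰ ρ)) (support ℱ)
    outer = composite-supported ℱ

    inner : ∀ ρ ℰ → SupportedOn (λ x → value ℰ x (value ℱ ℰ ρ)) (support ℰ)
    inner ρ ℰ = supported ℰ (value ℱ ℰ ρ)

    cpLinear : ∀ x → IsCPLinear (multiplication ℱ x)
    cpLinear x = ∑-CPLinear (λ ρ → outer ρ x)
                   (λ ℰ → ∘-CPLinear (outcome-CPLinear ℰ x) (outcome-CPLinear ℱ ℰ))

    isInstrument : IsInstrument (multiplication ℱ)
    isInstrument .linear x = isLinear (cpLinear x)
    isInstrument .completely-positive x = isCP (cpLinear x)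
    isInstrument .trace-nonincreasing x ρ pos =
      -- Each `ℰ` acts on the positive functional `value ℱ ℰ ρ` without raising its trace, and these
      -- traces add up to `τ ρ`.
      subst (τ (multiplication ℱ x ρ) C.≤_) (total-τ ℱ ρ)
        (τ-∑-mono (outer ρ x) (supported ℱ ρ)
          (λ ℰ → outcome-τ≤ ℰ x (value ℱ ℰ ρ) (outcome-positive ℱ ℰ ρ pos)))
    -- Once the sum over `x` is innermost, each `ℰ` preserves the trace of its input.
    isInstrument .trace-preserving ρ = begin
      τ (∑ (λ x → multiplication ℱ x ρ))                       ≡⟨ cong τ (∑-swap support (outer ρ) (inner ρ)) ⟨
      τ (∑ (λ ℰ → ∑ (λ x → value ℰ x (value ℱ ℰ ρ))))
        ≡⟨ τ-∑-cong (λ ℰ ℰ∉ → ∑-zero (λ x → outer ρ x ℰ ℰ∉)) (supported ℱ ρ)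
             (λ ℰ → total-τ ℰ (value ℱ ℰ ρ)) ⟩
      τ (∑ (λ ℰ → value ℱ ℰ ρ))                                ≡⟨ total-τ ℱ ρ ⟩
      τ ρ                                                      ∎
      where open ≡-Reasoning
    -- A nonzero outcome lies in the support of one of the finitely many instruments in `support ℱ`.
    isInstrument .finitary = concatMap support (support ℱ) , λ x x∉ ρ →
      ∑-zero (λ ℰ → SupportedOn-concatMap support (outer ρ) (inner ρ) ℰ x x∉)

  -- The monad laws.

  ∑-pushforward : {X Y : Set ℓ} (f : X → Y) (ℰ : Instrument X) (ρ : Predual)
                  {Φ : Y → Predual → Predual} → (∀ y → IsLinear (Φ y)) →
                  ∑ (λ y → Φ y (pushforward f ℰ y ρ)) ≡ ∑ (λ x → Φ (f x) (value ℰ x ρ))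
  ∑-pushforward f ℰ ρ = ∑-fibres f (supported ℰ ρ)

  outcome-linear : {X : Set ℓ} (x : X) (ℰ : Instrument X) → IsLinear (value ℰ x)
  outcome-linear x ℰ = isLinear (outcome-CPLinear ℰ x)

  map-identity : {X : Set ℓ} (ℰ : Instrument X) → map id ℰ ≡ ℰ
  map-identity ℰ = Instrument-ext λ y ρ →
    trans (∑-single y (λ x y≢x → if-no (y≢x ∘ sym))) (if-yes refl)

  map-compose : {X Y Z : Set ℓ} (g : Y → Z) (f : X → Y) (ℰ : Instrument X) →
                map (g ∘ f) ℰ ≡ map g (map f ℰ)
  map-compose g f ℰ = Instrument-ext λ z ρ →
    -- The linear maps here are the guards `g y ≡ z`.
    sym (∑-pushforward f ℰ ρ (λ y → isLinear (when-CPLinear (g y ≡ z) id-CPLinear)))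

  map-η : {X Y : Set ℓ} (f : X → Y) (x : X) → map f (η x) ≡ η (f x)
  map-η f x = Instrument-ext λ y ρ → begin
    ∑ (λ x′ → unit x x′ ρ when f x′ ≡ y)   ≡⟨ ∑-single x (λ x′ x≢x′ → when-zero (unit-≢ x≢x′ ρ)) ⟩
    (unit x x ρ when f x ≡ y)              ≡⟨ cong (_when f x ≡ y) (unit-≡ x ρ) ⟩
    (ρ when f x ≡ y)                       ≡⟨ unit-when (f x) y ρ ⟨
    unit (f x) y ρ                         ∎
    where open ≡-Reasoning

  -- Moving the sum over `x` inside turns each `ℰ` into `map f ℰ`. Distinct `ℰ` may have the same
  -- image; the change of variables along `map f` merges their terms.
  map-μ : {X Y : Set ℓ} (f : X → Y) (ℱ : Instrument (Instrument X)) → map f (μ ℱ) ≡ μ (map (map f) ℱ)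
  map-μ f ℱ = Instrument-ext λ y ρ → begin
    ∑ (λ x → multiplication ℱ x ρ when f x ≡ y)
      ≡⟨ ∑-cong (λ x → linear-∑ (isLinear (when-CPLinear (f x ≡ y) id-CPLinear))
                         (composite-supported ℱ ρ x)) ⟩
    ∑ (λ x → ∑ (λ ℰ → value ℰ x (value ℱ ℰ ρ) when f x ≡ y))
      ≡⟨ ∑-swap support (λ x ℰ ℰ∉ → when-zero (composite-supported ℱ ρ x ℰ ℰ∉))
           (λ ℰ x x∉ → when-zero (supported ℰ (value ℱ ℰ ρ) x x∉)) ⟨
    ∑ (λ ℰ → pushforward f ℰ y (value ℱ ℰ ρ))
      ≡⟨ ∑-pushforward (map f) ℱ ρ (outcome-linear y) ⟨
    multiplication (map (map f) ℱ) y ρ ∎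
    where open ≡-Reasoning

  μ-η : {X : Set ℓ} (ℰ : Instrument X) → μ (η ℰ) ≡ ℰ
  μ-η ℰ = Instrument-ext λ x ρ → trans
    (∑-single ℰ (λ ℰ′ ℰ≢ℰ′ → trans (cong (value ℰ′ x) (unit-≢ ℰ≢ℰ′ ρ)) (outcome-0 ℰ′ x)))
    (cong (value ℰ x) (unit-≡ ℰ ρ))

  -- Change of variables along `η` replaces the sum over instruments by one over points, where only
  -- `x` survives.
  μ-map-η : {X : Set ℓ} (ℰ : Instrument X) → μ (map η ℰ) ≡ ℰ
  μ-map-η ℰ = Instrument-ext λ x ρ → begin
    multiplication (map η ℰ) x ρ          ≡⟨ ∑-pushforward η ℰ ρ (outcome-linear x) ⟩
    ∑ (λ x′ → unit x′ x (value ℰ x′ ρ))   ≡⟨ ∑-single x (λ x′ x≢x′ → unit-≢ (x≢x′ ∘ sym) (value ℰ x′ ρ)) ⟩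
    unit x x (value ℰ x ρ)                ≡⟨ unit-≡ x (value ℰ x ρ) ⟩
    value ℰ x ρ                           ∎
    where open ≡-Reasoning

  -- Both sides become the double sum of `value ℰ x (value ℱ ℰ (value 𝒢 ℱ ρ))`: the left by
  -- linearity of `value ℰ x`, the right by change of variables along `μ`.
  μ-μ : {X : Set ℓ} (𝒢 : Instrument (Instrument (Instrument X))) → μ (μ 𝒢) ≡ μ (map μ 𝒢)
  μ-μ 𝒢 = Instrument-ext λ x ρ → begin
    ∑ (λ ℰ → value ℰ x (∑ (λ ℱ → value ℱ ℰ (value 𝒢 ℱ ρ))))
      ≡⟨ ∑-cong (λ ℰ → linear-∑ (outcome-linear x ℰ) (composite-supported 𝒢 ρ ℰ)) ⟩
    ∑ (λ ℰ → ∑ (λ ℱ → value ℰ x (value ℱ ℰ (value 𝒢 ℱ ρ))))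
      ≡⟨ ∑-swap support
           (λ ℰ ℱ ℱ∉ → trans (cong (value ℰ x) (composite-supported 𝒢 ρ ℰ ℱ ℱ∉)) (outcome-0 ℰ x))
           (λ ℱ → composite-supported ℱ (value 𝒢 ℱ ρ) x) ⟨
    ∑ (λ ℱ → multiplication ℱ x (value 𝒢 ℱ ρ))
      ≡⟨ ∑-pushforward μ 𝒢 ρ (outcome-linear x) ⟨
    multiplication (map μ 𝒢) x ρ ∎
    where open ≡-Reasoning

  instrumentMonad : Monad Instrument
  instrumentMonad = record
    { map       = map
    ; η         = η
    ; μ         = μ
    ; map-id    = ext map-identity
    ; map-∘     = λ g f → ext (map-compose g f)
    ; η-natural = λ f → ext (map-η f)
    ; μ-natural = λ f → ext (map-μ f)
    ; μ∘η       = ext μ-η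
    ; μ∘map-η   = ext μ-map-η
    ; μ-assoc   = ext μ-μ
    }

theorem3p5 : ∀ {ℓ : Level} (em : ExcludedMiddle ℓ) (ext : Extensionality ℓ ℓ) (ℝ : RealNumbers ℓ) (H : HilbertSpace ℝ) (𝒜 : VonNeumannAlgebra H) →
    let open Instruments em 𝒜 in
    Σ[ M ∈ Monad Instrument ]
    ( (∀ {X Y : Set ℓ} (f : X → Y) (ℰ : Instrument X) (y : Y) (ρ : Predual) →
    value (Monad.map M f ℰ) y ρ ≡ pushforward f ℰ y ρ)
    × (∀ {X : Set ℓ} (x x′ : X) (ρ : Predual) →
    value (Monad.η M x) x′ ρ ≡ unit x x′ ρ)
    × (∀ {X : Set ℓ} (ℱ : Instrument (Instrument X)) (x : X) (ρ : Predual) →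
    value (Monad.μ M ℱ) x ρ ≡ multiplication ℱ x ρ))
theorem3p5 em ext ℝ H 𝒜 =
  -- The monad operations were built on these formulas, so all three equations hold by definition.
  instrumentMonad , (λ _ _ _ _ → refl) , (λ _ _ _ → refl) , (λ _ _ _ → refl)
  where open InstrumentMonad em ext 𝒜
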